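{- Let $f$ be a positive integer with $f\equiv 4 \pmod 5$. Then $S_d\left(\frac{14f+4}{5},f\right)\le 3d$; that is, there is a search algorithm for $\frac{14f+4}{5}$ robots, at most $f$ of which are byzantine faulty, whose search time for a target at (unknown) distance $d$ from the origin is at most $3d$, for every $d>0$.
   Context: Model. $n$ robots with distinct identities start at time $0$ at the origin of the real line and move along the line with speed at most $1$, changing direction or speed at no cost. A target lies at an unknown point at distance $d>0$ from the origin, i.e. at $d$ or $-d$, with $d$ unknown to the robots. At most $f$ robots are faulty; the bound $f$ is known, but not which robots are faulty. A search algorithm assigns each robot a trajectory, known to all robots; a robot's further motion may depend on the messages broadcast so far (computation and communication take no time). A robot detects whether the target is at a point only by being there. The only messages are announcements "the target is here", heard instantly by all robots at any distance; each message automatically carries the true identity and true current location of its sender. A robot visiting a point silently is taken to claim that the target is not there. Reliable (non-faulty) robots follow the algorithm and report truthfully. Faulty robots are controlled by an adversary: they may stay silent at the target or announce the target where it is not; a faulty robot that broadcasts while off its assigned trajectory is thereby detected as faulty. The search is completed at the first time when some reliable robot has visited the target and announced it and all reliable robots can be certain of its location (every scenario with at most $f$ faulty robots consistent with the messages so far has the target at that location). For an algorithm, the search time $S_d(n,f)$ is the worst-case completion time over both positions $\pm d$ of the target, all choices of at most $f$ faulty robots, and all behaviours of the faulty robots. The inequality $S_d(n,f)\le cd$ means that there is an algorithm, not depending on $d$, with search time at most $cd$ for every $d>0$. -}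

module Defs where

open import Level using (0ℓ)
open import Algebra.Structures using (IsCommutativeRing)
open import Data.Bool using (Bool; T)
open import Data.Fin using (Fin)
import Data.Fin as Fin
open import Data.Fin.Subset using (Subset; ∣_∣; _∉_)
open import Data.List using (List; _∷_)
open import Data.List.Membership.Propositional using (_∈_)
open import Data.List.Relation.Unary.AllPairs using (AllPairs)
open import Data.Nat using (ℕ; zero; suc)
import Data.Nat as ℕ
open import Data.Product using (Σ; ∃; _×_)
open import Data.Sum using (_⊎_)
open import Function.Bundles using (_⇔_)
open import Relation.Binary.PropositionalEquality using (_≡_; _≢_)
open import Relation.Binary.Structures using (IsTotalOrder)
import Relation.Binary.Construct.NonStrictToStrict as ToStrict
open import Relation.Unary using (Pred)

-- Complete ordered fields; classically there is exactly one, the real numbers.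
record Reals : Set₁ where
  infixl 6 _+_ _-_
  infixl 7 _*_
  infix  8 -_
  infix  4 _≤_
  field
    ℝ                 : Set
    _+_ _*_           : ℝ → ℝ → ℝ
    -_                : ℝ → ℝ
    0# 1#             : ℝ
    _≤_               : ℝ → ℝ → Set
    isCommutativeRing : IsCommutativeRing _≡_ _+_ _*_ -_ 0# 1#
    0≢1               : 0# ≢ 1#
    inverse           : ∀ x → x ≢ 0# → ∃ λ y → x * y ≡ 1#
    isTotalOrder      : IsTotalOrder _≡_ _≤_
    +-monoʳ-≤         : ∀ x {y z} → y ≤ z → x + y ≤ x + z
    *-nonNegative     : ∀ {x y} → 0# ≤ x → 0# ≤ y → 0# ≤ x * y

  UpperBound : Pred ℝ 0ℓ → ℝ → Set
  UpperBound P b = ∀ {x} → P x → x ≤ b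

  field
    supremum : (P : Pred ℝ 0ℓ) → ∃ P → ∃ (UpperBound P) →
               ∃ λ s → UpperBound P s × (∀ b → UpperBound P b → s ≤ b)

  open ToStrict _≡_ _≤_ public using (_<_)

  _-_ : ℝ → ℝ → ℝ
  x - y = x + - y

  fromℕ : ℕ → ℝ
  fromℕ zero    = 0#
  fromℕ (suc k) = 1# + fromℕ k

module Search (R : Reals) where
  open Reals R

  -- Motion from the origin at speed at most 1.  Only times ≥ 0 are meaningful.
  record IsTrajectory (x : ℝ → ℝ) : Set where
    field
      start    : x 0# ≡ 0#
      forward  : ∀ {s t} → 0# ≤ s → s ≤ t → x t - x s ≤ t - s
      backward : ∀ {s t} → 0# ≤ s → s ≤ t → x s - x t ≤ t - s

  -- The announcement "the target is here".
  record Message (n : ℕ) : Set where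
    constructor message
    field
      sender   : Fin n
      time     : ℝ
      location : ℝ

  open Message public

  -- A list of messages is kept newest first, and simultaneous messages are
  -- ordered by sender, so that a finite set of messages (at most one per robot
  -- and instant) has exactly one ordered listing.
  Later : ∀ {n} → Message n → Message n → Set
  Later m m′ = time m′ < time m
             ⊎ (time m′ ≡ time m × sender m′ Fin.< sender m)

  Ordered : ∀ {n} → List (Message n) → Set
  Ordered = AllPairs Later

  -- plan H i is the whole trajectory, past and future, assigned to robot i when
  -- the messages heard are exactly H; a new message can only change the part
  -- after the time at which it was sent.
  record Algorithm (n : ℕ) : Set where
    field
      plan       : List (Message n) → Fin n → ℝ → ℝ
      trajectory : ∀ {H} → Ordered H → ∀ i → IsTrajectory (plan H i)
      causal     : ∀ {m H} → Ordered (m ∷ H) → ∀ i {t} → 0# ≤ t → t ≤ time m →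
                   plan (m ∷ H) i t ≡ plan H i t

  open Algorithm public

  -- A scenario: a target, a set of at most f faulty robots, and what all the
  -- robots do.  Faulty robots are restricted only by the speed bound, by the
  -- sender and location stamped on each message, and by there being finitely
  -- many messages in bounded time.
  record Run {n : ℕ} (A : Algorithm n) (f : ℕ) : Set where
    field
      target    : ℝ
      target≢0  : target ≢ 0#
      faulty    : Subset n
      faulty≤f  : ∣ faulty ∣ ℕ.≤ f
      position  : Fin n → ℝ → ℝ
      moves     : ∀ i → IsTrajectory (position i)
      announces : Fin n → ℝ → Bool

      -- heard t lists the messages sent up to and including time t.
      heard         : ℝ → List (Message n)
      heard-ordered : ∀ t → Ordered (heard t)
      heard-exactly : ∀ t m → m ∈ heard t ⇔
                      (0# ≤ time m × time m ≤ t
                        × T (announces (sender m) (time m))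
                        × location m ≡ position (sender m) (time m))

      follows  : ∀ {i} → i ∉ faulty → ∀ {t} → 0# ≤ t →
                 position i t ≡ plan A (heard t) i t
      truthful : ∀ {i} → i ∉ faulty → ∀ {t} → 0# ≤ t →
                 T (announces i t) → position i t ≡ target
      -- For the first visit this forces s to be t; announcing again on a later
      -- visit is optional.
      reports  : ∀ {i} → i ∉ faulty → ∀ {t} → 0# ≤ t → position i t ≡ target →
                 ∃ λ s → 0# ≤ s × s ≤ t × T (announces i s)

  open Run public

  module _ {n : ℕ} {A : Algorithm n} {f : ℕ} where

    Certain : Run A f → ℝ → Set
    Certain r t = (r′ : Run A f) → heard r′ t ≡ heard r t → target r′ ≡ target r

    FoundByReliable : Run A f → ℝ → Set
    FoundByReliable r t =
      ∃ λ i → i ∉ faulty r ×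
        ∃ λ s → 0# ≤ s × s ≤ t × position r i s ≡ target r × T (announces r i s)

    Completed : Run A f → ℝ → Set
    Completed r t = FoundByReliable r t × Certain r t

  -- The search time of A for targets at distance d is at most b.
  SearchTime≤ : ∀ {n} → Algorithm n → (f : ℕ) (d b : ℝ) → Set
  SearchTime≤ A f d b =
    (r : Run A f) → target r ≡ d ⊎ target r ≡ - d →
    ∃ λ t → 0# ≤ t × t ≤ b × Completed r t

  -- S_d(n, f) ≤ c d.
  S[_,_]≤_·d : ℕ → ℕ → ℝ → Set
  S[ n , f ]≤ c ·d =
    Σ (Algorithm n) λ A → ∀ d → 0# < d → SearchTime≤ A f d (c * d)

-- Write f = 5k + 4, so that there are 14k + 12 robots: a wing of 7k + 6 on each
-- side, each made up of a fixed squad of 4k + 3 and a mobile squad of 3k + 3.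
-- Both wings move outwards at speed 1.  At the first time c at which at least
-- 2k + 2 robots of one wing claim the target at their place, the mobile squad of
-- the other wing sets out towards that place, reaching every point at distance
-- d ≥ c on that side by time d + 2c ≤ 3d.  Should the fixed squad it left behind
-- later make a claim so large that the first one must be false, the mobile squad
-- turns round and follows it for ever; it then reaches a point at distance d on
-- its own side by time 3d.
--
-- Suppose two scenarios with targets x ≠ y, |x| = d ≤ |y|, and faulty sets F, F′
-- give the same messages up to time 3d.  Robots that visit x or y by then lie in
-- F ∪ F′, and robots that claim a third place lie in F ∩ F′.  In every case too
-- many robots do so for |F ∪ F′| + |F ∩ F′| ≤ 2f.
module Submission where

open import Defs
open import Level using (0ℓ)
open import Algebra.Bundles using (AbelianGroup)
import Algebra.Properties.AbelianGroup as AbelianGroupProperties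
open import Algebra.Structures using (IsCommutativeRing)
open import Axiom.ExcludedMiddle using (ExcludedMiddle)
open import Data.Bool using (true; false)
open import Data.Empty using (⊥; ⊥-elim)
open import Data.Fin using (Fin)
import Data.Fin as Fin
open import Data.Fin.Properties using (<-asym)
open import Data.Fin.Subset using (Subset; ∣_∣; _∈_; _∉_; _⊆_; _∪_; _∩_)
  renaming (⊥ to ∅)
open import Data.Fin.Subset.Properties
  using (_∈?_; drop-there; ∣p∣≤∣x∷p∣; ∪-comm; ∣⊥∣≡0; p⊆q⇒∣p∣≤∣q∣; x∈p∩q⁺; x∈p∩q⁻; x∈p∪q⁺; x∈p∪q⁻)
open import Data.List using (List; []; _∷_)
open import Data.List.Membership.Propositional using () renaming (_∈_ to _∈ₗ_)
open import Data.List.Relation.Unary.All as All using (All)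
open import Data.List.Relation.Unary.AllPairs using () renaming (_∷_ to _∷ₚ_)
open import Data.List.Relation.Unary.Any using (here; there)
import Data.Nat as ℕ
import Data.Nat.Properties as ℕₚ
open import Data.Nat.Tactic.RingSolver using (solve-∀)
open import Data.Product using (∃; _×_; _,_; proj₁; proj₂)
open import Data.Sum using (_⊎_; inj₁; inj₂; [_,_]′)
open import Data.Vec using (Vec; []; _∷_; _++_; count; lookup; replicate; tabulate)
open import Data.Vec.Properties using ([]=⇒lookup; lookup⇒[]=; lookup∘tabulate)
open import Function using (case_of_)
open import Function.Bundles using (Equivalence)
open import Relation.Binary.PropositionalEquality
  using (_≡_; _≢_; refl; sym; trans; cong; cong₂; subst; subst₂; module ≡-Reasoning)
open import Relation.Binary.Structures using (IsTotalOrder)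
open import Relation.Nullary using (¬_; Dec; yes; no; does)
open import Relation.Nullary.Decidable using (dec-true)

open Equivalence using (to; from)

-- Cardinalities of unions and of disjoint subsets.

module Cardinality where
  open ℕ using (ℕ; suc; _+_; _≤_)

  private variable
    n : ℕ

  ∣p∪q∣+∣p∩q∣≡∣p∣+∣q∣ : (p q : Subset n) → ∣ p ∪ q ∣ + ∣ p ∩ q ∣ ≡ ∣ p ∣ + ∣ q ∣
  ∣p∪q∣+∣p∩q∣≡∣p∣+∣q∣ []          []          = refl
  ∣p∪q∣+∣p∩q∣≡∣p∣+∣q∣ (true  ∷ p) (true  ∷ q) = cong suc (trans (ℕₚ.+-suc _ _)
    (trans (cong suc (∣p∪q∣+∣p∩q∣≡∣p∣+∣q∣ p q)) (sym (ℕₚ.+-suc _ _))))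
  ∣p∪q∣+∣p∩q∣≡∣p∣+∣q∣ (true  ∷ p) (false ∷ q) = cong suc (∣p∪q∣+∣p∩q∣≡∣p∣+∣q∣ p q)
  ∣p∪q∣+∣p∩q∣≡∣p∣+∣q∣ (false ∷ p) (true  ∷ q) =
    trans (cong suc (∣p∪q∣+∣p∩q∣≡∣p∣+∣q∣ p q)) (sym (ℕₚ.+-suc _ _))
  ∣p∪q∣+∣p∩q∣≡∣p∣+∣q∣ (false ∷ p) (false ∷ q) = ∣p∪q∣+∣p∩q∣≡∣p∣+∣q∣ p q

  p⊆q∪r⇒∣p∣≤∣q∣+∣r∣ : (p q r : Subset n) → p ⊆ q ∪ r → ∣ p ∣ ≤ ∣ q ∣ + ∣ r ∣
  p⊆q∪r⇒∣p∣≤∣q∣+∣r∣ p q r p⊆q∪r = begin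
    ∣ p ∣                     ≤⟨ p⊆q⇒∣p∣≤∣q∣ p⊆q∪r ⟩
    ∣ q ∪ r ∣                 ≤⟨ ℕₚ.m≤m+n _ _ ⟩
    ∣ q ∪ r ∣ + ∣ q ∩ r ∣     ≡⟨ ∣p∪q∣+∣p∩q∣≡∣p∣+∣q∣ q r ⟩
    ∣ q ∣ + ∣ r ∣             ∎
    where open ℕₚ.≤-Reasoning

  disjoint⇒∣p∣+∣q∣≤∣r∣ : (p q r : Subset n) → (∀ {i} → i ∈ p → i ∉ q) →
                        p ⊆ r → q ⊆ r → ∣ p ∣ + ∣ q ∣ ≤ ∣ r ∣
  disjoint⇒∣p∣+∣q∣≤∣r∣ {n} p q r disjoint p⊆r q⊆r = begin
    ∣ p ∣ + ∣ q ∣             ≡⟨ ∣p∪q∣+∣p∩q∣≡∣p∣+∣q∣ p q ⟨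
    ∣ p ∪ q ∣ + ∣ p ∩ q ∣     ≤⟨ ℕₚ.+-mono-≤ (p⊆q⇒∣p∣≤∣q∣ p∪q⊆r) (p⊆q⇒∣p∣≤∣q∣ p∩q⊆∅) ⟩
    ∣ r ∣ + ∣ ∅ {n} ∣         ≡⟨ cong (∣ r ∣ +_) (∣⊥∣≡0 n) ⟩
    ∣ r ∣ + 0                 ≡⟨ ℕₚ.+-identityʳ _ ⟩
    ∣ r ∣                     ∎
    where
    open ℕₚ.≤-Reasoning
    p∪q⊆r : p ∪ q ⊆ r
    p∪q⊆r i∈p∪q with x∈p∪q⁻ p q i∈p∪q
    ... | inj₁ i∈p = p⊆r i∈p
    ... | inj₂ i∈q = q⊆r i∈q
    p∩q⊆∅ : p ∩ q ⊆ ∅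
    p∩q⊆∅ i∈p∩q with x∈p∩q⁻ p q i∈p∩q
    ... | i∈p , i∈q = ⊥-elim (disjoint i∈p i∈q)

  disjoint⇒∣p∣+∣q∣≤∣r∣+∣s∣ : (p q r s : Subset n) → (∀ {i} → i ∈ p → i ∉ q) →
                            p ⊆ r ∪ s → q ⊆ r ∪ s → ∣ p ∣ + ∣ q ∣ ≤ ∣ r ∣ + ∣ s ∣
  disjoint⇒∣p∣+∣q∣≤∣r∣+∣s∣ p q r s disjoint p⊆r∪s q⊆r∪s =
    ℕₚ.≤-trans (disjoint⇒∣p∣+∣q∣≤∣r∣ p q (r ∪ s) disjoint p⊆r∪s q⊆r∪s)
               (p⊆q∪r⇒∣p∣≤∣q∣+∣r∣ (r ∪ s) r s (λ i∈ → i∈))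

-- Counting inequalities in `k`: claimants against faults.

module Arithmetic (k : ℕ.ℕ) where
  open ℕ using (ℕ; suc; _+_; _*_; _≤_)

  private variable
    a b w v v′ φ U I : ℕ

  infixr 4 _⊕_
  _⊕_ : ∀ {a b c d} → a ≤ b → c ≤ d → a + c ≤ b + d
  _⊕_ = ℕₚ.+-mono-≤

  abstract
    -- Linear inequalities are proved by adding up the hypotheses with `_⊕_`; `solve-∀` then
    -- identifies both sides of the sum with the sides of the goal plus a common summand `z`.
    cancel : ∀ {a b l r} z → a ≤ b → a ≡ l + z → b ≡ r + z → l ≤ r
    cancel z a≤b refl refl = ℕₚ.+-cancelʳ-≤ z _ _ a≤b

    -- The same scheme for contradictions: in the sum of the hypotheses the smaller side turns out
    -- to exceed the larger one by the positive number `suc s`.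
    excess : ∀ {a b} s → a ≤ b → a ≢ suc s + b
    excess {b = b} s a≤b refl = ℕₚ.<⇒≱ (ℕₚ.m≤n+m (suc b) s) (ℕₚ.≤-trans (ℕₚ.≤-reflexive (ℕₚ.+-suc s b)) a≤b)

    -- `w` counts a wing, `v` the claimants of a false claim, `v′` those of the true claim and `φ`
    -- the faults. The margin 2k + 2 is the excess of a wing over f = 5k + 4.
    outnumber : 7 * k + 6 ≤ w → w + v ≤ v′ + φ → φ ≤ 5 * k + 4 → v + (2 * k + 2) ≤ v′
    outnumber {w} {v} {v′} {φ} h₁ h₂ h₃ =
      cancel (5 * k + 4 + w + φ) (h₁ ⊕ h₂ ⊕ h₃) (lhs k w v φ) (rhs k w v′ φ)
      where
      lhs : ∀ k w v φ → 7 * k + 6 + (w + v + φ) ≡ v + (2 * k + 2) + (5 * k + 4 + w + φ)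
      lhs = solve-∀
      rhs : ∀ k w v φ → w + (v + φ + (5 * k + 4)) ≡ v + (5 * k + 4 + w + φ)
      rhs = solve-∀

    -- Here `w` counts a fixed squad, which falls short of f by k + 1.
    recalls : 4 * k + 3 ≤ w → w + v ≤ v′ + φ → φ ≤ 5 * k + 4 → v ≤ v′ + (k + 1)
    recalls {w} {v} {v′} {φ} h₁ h₂ h₃ =
      cancel (4 * k + 3 + w + φ) (h₁ ⊕ h₂ ⊕ h₃) (lhs k w v φ) (rhs k w v′ φ)
      where
      lhs : ∀ k w v φ → 4 * k + 3 + (w + v + φ) ≡ v + (4 * k + 3 + w + φ)
      lhs = solve-∀
      rhs : ∀ k w v φ → w + (v + φ + (5 * k + 4)) ≡ v + (k + 1) + (4 * k + 3 + w + φ)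
      rhs = solve-∀

    outnumber-asym : v + (2 * k + 2) ≤ v′ → ¬ (v′ + (2 * k + 2) ≤ v)
    outnumber-asym {v} {v′} h₁ h₂ = excess (4 * k + 3) (h₁ ⊕ h₂) (eq k v v′)
      where
      eq : ∀ k v v′ → v + (2 * k + 2) + (v′ + (2 * k + 2)) ≡ suc (4 * k + 3) + (v′ + v)
      eq = solve-∀

    -- Both claims being false costs `v + v′`, at least 3(2k + 2) = 6k + 6 faults.
    two-claims-exceed : 2 * k + 2 ≤ v → v + (2 * k + 2) ≤ v′ → v + v′ ≤ φ → ¬ (φ ≤ 5 * k + 4)
    two-claims-exceed {v} {v′} {φ} h₁ h₂ h₃ h₄ =
      excess (k + 1) (h₁ ⊕ h₁ ⊕ h₂ ⊕ h₃ ⊕ h₄) (eq k v v′ φ)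
      where
      eq : ∀ k v v′ φ → 2 * k + 2 + (2 * k + 2 + (v + (2 * k + 2) + (v + v′ + φ))) ≡
                        suc (k + 1) + (v + (v + (v′ + (φ + (5 * k + 4)))))
      eq = solve-∀

    -- The faults number at least `w` less the deficit k + 1, that is 6k + 5.
    recall-exceeds : 7 * k + 6 ≤ w → w + v′ ≤ v + φ → v ≤ v′ + (k + 1) → ¬ (φ ≤ 5 * k + 4)
    recall-exceeds {w} {v′} {v} {φ} h₁ h₂ h₃ h₄ = excess k (h₁ ⊕ h₂ ⊕ h₃ ⊕ h₄) (eq k w v v′ φ)
      where
      eq : ∀ k w v v′ φ → 7 * k + 6 + (w + v′ + (v + φ)) ≡
                          suc k + (w + (v + φ + (v′ + (k + 1) + (5 * k + 4))))
      eq = solve-∀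

    -- `U` and `I` are the sizes of the union and the intersection of two faulty sets. The total 7k
    -- + 6 + 3k + 3 = 10k + 9 is just one more than 2f.
    two-runs-exceed : 7 * k + 6 ≤ w → w + a ≤ U → b ≤ I → 3 * k + 3 ≤ a + b →
                      ¬ (U + I ≤ (5 * k + 4) + (5 * k + 4))
    two-runs-exceed {w} {a} {U} {b} {I} h₁ h₂ h₃ h₄ h₅ =
      excess 0 (h₁ ⊕ h₂ ⊕ h₃ ⊕ h₄ ⊕ h₅) (eq k w a b U I)
      where
      eq : ∀ k w a b U I → 7 * k + 6 + (w + a + (b + (3 * k + 3 + (U + I)))) ≡
                           1 + (w + (U + (I + (a + b + ((5 * k + 4) + (5 * k + 4))))))
      eq = solve-∀

    wing-exceeds : 7 * k + 6 ≤ w → w ≤ φ → ¬ (φ ≤ 5 * k + 4)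
    wing-exceeds {w} {φ} h₁ h₂ h₃ = excess (2 * k + 1) (h₁ ⊕ h₂ ⊕ h₃) (eq k w φ)
      where
      eq : ∀ k w φ → 7 * k + 6 + (w + φ) ≡ suc (2 * k + 1) + (w + (φ + (5 * k + 4)))
      eq = solve-∀

    squad-exceeds : 4 * k + 3 ≤ w → 2 * k + 2 ≤ v → w + v ≤ φ → ¬ (φ ≤ 5 * k + 4)
    squad-exceeds {w} {v} {φ} h₁ h₂ h₃ h₄ = excess k (h₁ ⊕ h₂ ⊕ h₃ ⊕ h₄) (eq k w v φ)
      where
      eq : ∀ k w v φ → 4 * k + 3 + (2 * k + 2 + (w + v + φ)) ≡ suc k + (w + (v + (φ + (5 * k + 4))))
      eq = solve-∀

    4k+3+3k+3≡7k+6 : 4 * k + 3 + (3 * k + 3) ≡ 7 * k + 6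
    4k+3+3k+3≡7k+6 = eq k
      where
      eq : ∀ k → 4 * k + 3 + (3 * k + 3) ≡ 7 * k + 6
      eq = solve-∀

    3k+3≤4k+3 : 3 * k + 3 ≤ 4 * k + 3
    3k+3≤4k+3 = ℕₚ.+-monoˡ-≤ 3 (ℕₚ.*-monoˡ-≤ k (ℕₚ.n≤1+n 3))

    3k+3≤[k+1]+[2k+2] : 3 * k + 3 ≤ (k + 1) + (2 * k + 2)
    3k+3≤[k+1]+[2k+2] = ℕₚ.≤-reflexive (eq k)
      where
      eq : ∀ k → 3 * k + 3 ≡ (k + 1) + (2 * k + 2)
      eq = solve-∀

    k+1≤2k+2 : k + 1 ≤ 2 * k + 2
    k+1≤2k+2 = ℕₚ.+-mono-≤ (ℕₚ.m≤m+n k (k + 0)) (ℕₚ.n≤1+n 1)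

-- The two sides of the origin.

data Side : Set where
  left right : Side

opposite : Side → Side
opposite left  = right
opposite right = left

same-or-opposite : ∀ σ τ → τ ≡ σ ⊎ τ ≡ opposite σ
same-or-opposite left  left  = inj₁ refl
same-or-opposite left  right = inj₂ refl
same-or-opposite right left  = inj₂ refl
same-or-opposite right right = inj₁ refl

opposite-≢ : ∀ σ → opposite σ ≢ σ
opposite-≢ left  ()
opposite-≢ right ()

opposite-involutive : ∀ σ → opposite (opposite σ) ≡ σ
opposite-involutive left  = refl
opposite-involutive right = refl

-- Ordered-field arithmetic and signed points of the line.

module Line (R : Reals) where
  open Reals R
  open IsCommutativeRing isCommutativeRing public
    using (+-comm; +-assoc; +-identityʳ; -‿inverseʳ; +-isAbelianGroup
          ; *-identityˡ; distribʳ)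
  open IsTotalOrder isTotalOrder public
    using (antisym; total; reflexive) renaming (refl to ≤-refl; trans to ≤-trans)

  +-abelianGroup : AbelianGroup 0ℓ 0ℓ
  +-abelianGroup = record { isAbelianGroup = +-isAbelianGroup }

  open AbelianGroupProperties +-abelianGroup public
    using ()
    renaming ( ⁻¹-anti-homo‿- to -‿anti-homo--
             ; xyx⁻¹≈y to x+y-x≡y
             ; ⁻¹-∙-comm to -‿+-comm
             ; ⁻¹-involutive to -‿involutive
             ; ε⁻¹≈ε to -0#≡0#
             ; \\-leftDividesˡ to x+[-x+y]≡y
             ; \\-leftDividesʳ to -x+[x+y]≡y
             ; //-rightDividesˡ to [y-x]+x≡y )

  open ≡-Reasoning

  <⇒≤ : ∀ {x y} → x < y → x ≤ y
  <⇒≤ = proj₁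

  <-irrefl : ∀ {x} → ¬ (x < x)
  <-irrefl (_ , x≢x) = x≢x refl

  <-≤-trans : ∀ {x y z} → x < y → y ≤ z → x < z
  <-≤-trans (x≤y , x≢y) y≤z = ≤-trans x≤y y≤z , λ { refl → x≢y (antisym x≤y y≤z) }

  ≤-<-trans : ∀ {x y z} → x ≤ y → y < z → x < z
  ≤-<-trans x≤y (y≤z , y≢z) = ≤-trans x≤y y≤z , λ { refl → y≢z (antisym y≤z x≤y) }

  <⇒≱ : ∀ {x y} → x < y → ¬ (y ≤ x)
  <⇒≱ x<y y≤x = <-irrefl (<-≤-trans x<y y≤x)

  ≰⇒> : ∀ {x y} → ¬ (x ≤ y) → y < x
  ≰⇒> {x} {y} x≰y with total x y
  ... | inj₁ x≤y = ⊥-elim (x≰y x≤y)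
  ... | inj₂ y≤x = y≤x , λ { refl → x≰y ≤-refl }

  +-monoˡ-≤ : ∀ z {x y} → x ≤ y → x + z ≤ y + z
  +-monoˡ-≤ z {x} {y} x≤y = subst₂ _≤_ (+-comm z x) (+-comm z y) (+-monoʳ-≤ z x≤y)

  +-mono-≤ : ∀ {x y u v} → x ≤ y → u ≤ v → x + u ≤ y + v
  +-mono-≤ {y = y} {u} x≤y u≤v = ≤-trans (+-monoˡ-≤ u x≤y) (+-monoʳ-≤ y u≤v)

  x≤y⇒0≤y-x : ∀ {x y} → x ≤ y → 0# ≤ y - x
  x≤y⇒0≤y-x {x} {y} x≤y = subst (_≤ y - x) (-‿inverseʳ x) (+-monoˡ-≤ (- x) x≤y)

  neg-antimono-≤ : ∀ {x y} → x ≤ y → - y ≤ - x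
  neg-antimono-≤ {x} {y} x≤y =
    subst₂ _≤_ (+-identityʳ (- y)) (-x+[x+y]≡y y (- x)) (+-monoʳ-≤ (- y) (x≤y⇒0≤y-x x≤y))

  0≤x⇒-x≤0 : ∀ {x} → 0# ≤ x → - x ≤ 0#
  0≤x⇒-x≤0 {x} 0≤x = subst (- x ≤_) -0#≡0# (neg-antimono-≤ 0≤x)

  0≤x⇒y≤y+x : ∀ {x} y → 0# ≤ x → y ≤ y + x
  0≤x⇒y≤y+x {x} y 0≤x = subst (_≤ y + x) (+-identityʳ y) (+-monoʳ-≤ y 0≤x)

  0≤x⇒y-x≤y : ∀ {x} y → 0# ≤ x → y - x ≤ y
  0≤x⇒y-x≤y {x} y 0≤x = subst (y - x ≤_) (+-identityʳ y) (+-monoʳ-≤ y (0≤x⇒-x≤0 0≤x))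

  telescope : ∀ x y z → (x - y) + (y - z) ≡ x - z
  telescope x y z = begin
    (x - y) + (y - z)    ≡⟨ +-assoc x (- y) (y - z) ⟩
    x + (- y + (y - z))  ≡⟨ cong (x +_) (-x+[x+y]≡y y (- z)) ⟩
    x - z                ∎

  3*x≡x+[x+x] : ∀ x → fromℕ 3 * x ≡ x + (x + x)
  3*x≡x+[x+x] x = begin
    (1# + (1# + (1# + 0#))) * x        ≡⟨ distribʳ x 1# _ ⟩
    1# * x + (1# + (1# + 0#)) * x      ≡⟨ cong₂ _+_ (*-identityˡ x) (distribʳ x 1# _) ⟩
    x + (1# * x + (1# + 0#) * x)       ≡⟨ cong (x +_) (cong₂ _+_ (*-identityˡ x)
                                            (trans (cong (_* x) (+-identityʳ 1#)) (*-identityˡ x))) ⟩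
    x + (x + x)                        ∎

  infix 4 ∣_∣≤_
  ∣_∣≤_ : ℝ → ℝ → Set
  ∣ x ∣≤ b = x ≤ b × - x ≤ b

  ∣∣≤-+ : ∀ {x y b c} → ∣ x ∣≤ b → ∣ y ∣≤ c → ∣ x + y ∣≤ b + c
  ∣∣≤-+ {x} {y} {b} {c} (x≤b , -x≤b) (y≤c , -y≤c) =
    +-mono-≤ x≤b y≤c , subst (_≤ b + c) (-‿+-comm x y) (+-mono-≤ -x≤b -y≤c)

  infix 7 _·_
  -- For positive `d`, `σ · d` is the point of side `σ` at distance `d`. Negative arguments lie on
  -- the opposite side, so one formula follows a robot across the origin.
  _·_ : Side → ℝ → ℝ
  left  · x = - x
  right · x = x

  ·-0# : ∀ σ → σ · 0# ≡ 0#
  ·-0# left  = -0#≡0#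
  ·-0# right = refl

  ·-+ : ∀ σ x y → σ · (x + y) ≡ σ · x + σ · y
  ·-+ left  x y = sym (-‿+-comm x y)
  ·-+ right x y = refl

  ·-neg : ∀ σ x → σ · (- x) ≡ - (σ · x)
  ·-neg left  x = refl
  ·-neg right x = refl

  ·-- : ∀ σ x y → σ · (x - y) ≡ σ · x - σ · y
  ·-- σ x y = trans (·-+ σ x (- y)) (cong (σ · x +_) (·-neg σ y))

  opposite-· : ∀ σ x → opposite σ · x ≡ σ · (- x)
  opposite-· left  x = sym (-‿involutive x)
  opposite-· right x = refl

  ∣σ·x∣≤x : ∀ σ {x} → 0# ≤ x → ∣ σ · x ∣≤ x
  ∣σ·x∣≤x left  {x} 0≤x = ≤-trans (0≤x⇒-x≤0 0≤x) 0≤x , reflexive (-‿involutive x)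
  ∣σ·x∣≤x right {x} 0≤x = ≤-refl , ≤-trans (0≤x⇒-x≤0 0≤x) 0≤x

  ∣σ·x∣≤b⇒x≤b : ∀ σ {x b} → ∣ σ · x ∣≤ b → x ≤ b
  ∣σ·x∣≤b⇒x≤b left  {x} {b} (_ , h) = subst (_≤ b) (-‿involutive x) h
  ∣σ·x∣≤b⇒x≤b right (h , _) = h

  left·≢right· : ∀ {x y} → 0# < x → 0# < y → left · x ≢ right · y
  left·≢right· {x} 0<x 0<y -x≡y =
    <⇒≱ 0<y (subst (_≤ 0#) -x≡y (0≤x⇒-x≤0 (<⇒≤ 0<x)))

  ·-injective : ∀ {σ τ x y} → 0# < x → 0# < y → σ · x ≡ τ · y → σ ≡ τ × x ≡ y
  ·-injective {left}  {left}  {x} {y} _ _ -x≡-y =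
    refl , trans (sym (-‿involutive x)) (trans (cong -_ -x≡-y) (-‿involutive y))
  ·-injective {left}  {right} 0<x 0<y eq = ⊥-elim (left·≢right· 0<x 0<y eq)
  ·-injective {right} {left}  0<x 0<y eq = ⊥-elim (left·≢right· 0<y 0<x (sym eq))
  ·-injective {right} {right} _ _ x≡y = refl , x≡y

  ·-polar : ∀ x → x ≢ 0# → ∃ λ σ → ∃ λ d → 0# < d × x ≡ σ · d
  ·-polar x x≢0 with total 0# x
  ... | inj₁ 0≤x = right , x , (0≤x , λ 0≡x → x≢0 (sym 0≡x)) , refl
  ... | inj₂ x≤0 = left , - x ,
    (subst (_≤ - x) -0#≡0# (neg-antimono-≤ x≤0) ,
     λ 0≡-x → x≢0 (trans (sym (-‿involutive x)) (trans (cong -_ (sym 0≡-x)) -0#≡0#))) ,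
    sym (-‿involutive x)

-- Straight and bent trajectories and their arrival times.

module Motion (R : Reals) where
  open Reals R
  open Line R
  open Search R using (IsTrajectory)
  open ≡-Reasoning

  trajectory-∣∣≤ : ∀ {x} → IsTrajectory x → ∀ {s t} → 0# ≤ s → s ≤ t → ∣ x t - x s ∣≤ t - s
  trajectory-∣∣≤ {x} traj {s} {t} 0≤s s≤t = forward 0≤s s≤t ,
    subst (_≤ t - s) (sym (-‿anti-homo-- (x t) (x s))) (backward 0≤s s≤t)
    where open IsTrajectory traj

  mkTrajectory : ∀ {x} → x 0# ≡ 0# →
    (∀ {s t} → 0# ≤ s → s ≤ t → ∣ x t - x s ∣≤ t - s) → IsTrajectory x
  mkTrajectory {x} start speed = record
    { start    = start
    ; forward  = λ 0≤s s≤t → proj₁ (speed 0≤s s≤t)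
    ; backward = λ {s} {t} 0≤s s≤t →
        subst (_≤ t - s) (-‿anti-homo-- (x t) (x s)) (proj₂ (speed 0≤s s≤t))
    }

  distance≤time : ∀ {x} → IsTrajectory x → ∀ {s σ d} → 0# ≤ s → x s ≡ σ · d → d ≤ s
  distance≤time {x} traj {s} {σ} 0≤s xs≡σ·d = ∣σ·x∣≤b⇒x≤b σ
    (subst₂ ∣_∣≤_
      (trans (cong (λ a → x s - a) (IsTrajectory.start traj))
        (trans (y-0 (x s)) xs≡σ·d))
      (y-0 s)
      (trajectory-∣∣≤ traj ≤-refl 0≤s))
    where
    y-0 : ∀ y → y - 0# ≡ y
    y-0 y = trans (cong (y +_) -0#≡0#) (+-identityʳ y)

  straight : Side → ℝ → ℝ
  straight σ t = σ · t

  straight-trajectory : ∀ σ → IsTrajectory (straight σ)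
  straight-trajectory σ = mkTrajectory (·-0# σ) λ {s} {t} _ s≤t →
    subst (∣_∣≤ t - s) (·-- σ t s) (∣σ·x∣≤x σ (x≤y⇒0≤y-x s≤t))

  -- Totality of the order serves as the case distinction. At `t = c` it may answer either way, but
  -- both branches agree there.
  bend : (ℝ → ℝ) → ℝ → Side → ℝ → ℝ
  bend g c σ t with total t c
  ... | inj₁ _ = g t
  ... | inj₂ _ = g c + σ · (t - c)

  private
    at-bend : ∀ (g : ℝ → ℝ) c σ → g c + σ · (c - c) ≡ g c
    at-bend g c σ = trans (cong (g c +_) (trans (cong (σ ·_) (-‿inverseʳ c)) (·-0# σ)))
                          (+-identityʳ (g c))

  bend-before : ∀ g {c} σ {t} → t ≤ c → bend g c σ t ≡ g t
  bend-before g {c} σ {t} t≤c with total t c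
  ... | inj₁ _ = refl
  ... | inj₂ c≤t with antisym t≤c c≤t
  ...   | refl = at-bend g c σ

  bend-after : ∀ g {c} σ {t} → c ≤ t → bend g c σ t ≡ g c + σ · (t - c)
  bend-after g {c} σ {t} c≤t with total t c
  ... | inj₂ _ = refl
  ... | inj₁ t≤c with antisym t≤c c≤t
  ...   | refl = sym (at-bend g c σ)

  bend-trajectory : ∀ {g c} σ → IsTrajectory g → 0# ≤ c → IsTrajectory (bend g c σ)
  bend-trajectory {g} {c} σ traj 0≤c = mkTrajectory
    (trans (bend-before g σ 0≤c) (IsTrajectory.start traj)) speed
    where
    speed-before : ∀ {s t} → 0# ≤ s → s ≤ t → t ≤ c → ∣ bend g c σ t - bend g c σ s ∣≤ t - s
    speed-before {s} {t} 0≤s s≤t t≤c = subst (∣_∣≤ t - s)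
      (sym (cong₂ _-_ (bend-before g σ t≤c) (bend-before g σ (≤-trans s≤t t≤c))))
      (trajectory-∣∣≤ traj 0≤s s≤t)

    speed-after : ∀ {s t} → c ≤ s → s ≤ t → ∣ bend g c σ t - bend g c σ s ∣≤ t - s
    speed-after {s} {t} c≤s s≤t = subst (∣_∣≤ t - s) (sym (begin
      bend g c σ t - bend g c σ s
        ≡⟨ cong₂ _-_ (bend-after g σ (≤-trans c≤s s≤t)) (bend-after g σ c≤s) ⟩
      (g c + σ · (t - c)) - (g c + σ · (s - c))
        ≡⟨ cong (_- (g c + σ · (s - c))) (+-comm (g c) _) ⟩
      (σ · (t - c) + g c) - (g c + σ · (s - c))
        ≡⟨ cong (σ · (t - c) + g c +_) (sym (-‿+-comm (g c) _)) ⟩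
      (σ · (t - c) + g c) + (- g c - σ · (s - c))
        -- Rewriting `g c` as a double negation lets `telescope` cancel it with middle term `- g c`.
        ≡⟨ cong (λ a → σ · (t - c) + a + (- g c - σ · (s - c))) (sym (-‿involutive (g c))) ⟩
      (σ · (t - c) - - g c) + (- g c - σ · (s - c))
        ≡⟨ telescope (σ · (t - c)) (- g c) (σ · (s - c)) ⟩
      σ · (t - c) - σ · (s - c)
        ≡⟨ sym (·-- σ (t - c) (s - c)) ⟩
      σ · ((t - c) - (s - c))
        ≡⟨ cong (λ a → σ · ((t - c) + a)) (-‿anti-homo-- s c) ⟩
      σ · ((t - c) + (c - s))
        ≡⟨ cong (σ ·_) (telescope t c s) ⟩
      σ · (t - s) ∎))
      (∣σ·x∣≤x σ (x≤y⇒0≤y-x s≤t))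

    speed : ∀ {s t} → 0# ≤ s → s ≤ t → ∣ bend g c σ t - bend g c σ s ∣≤ t - s
    speed {s} {t} 0≤s s≤t = split (total t c) (total c s)
      where
      split : t ≤ c ⊎ c ≤ t → c ≤ s ⊎ s ≤ c → ∣ bend g c σ t - bend g c σ s ∣≤ t - s
      split (inj₁ t≤c) _          = speed-before 0≤s s≤t t≤c
      split (inj₂ _)   (inj₁ c≤s) = speed-after c≤s s≤t
      -- An interval that contains `c` is cut there, and the bounds for the two pieces add up.
      split (inj₂ c≤t) (inj₂ s≤c) = subst₂ ∣_∣≤_
        (telescope (bend g c σ t) (bend g c σ c) (bend g c σ s)) (telescope t c s)
        (∣∣≤-+ (speed-after ≤-refl c≤t) (speed-before 0≤s s≤c ≤-refl))

  detour : Side → ℝ → ℝ → ℝ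
  detour τ c = bend (straight τ) c (opposite τ)

  comeback : Side → ℝ → ℝ → ℝ → ℝ
  comeback τ c c′ = bend (detour τ c) c′ τ

  detour-after : ∀ τ {c t} → c ≤ t → detour τ c t ≡ τ · (c - (t - c))
  detour-after τ {c} {t} c≤t = begin
    detour τ c t                       ≡⟨ bend-after (straight τ) (opposite τ) c≤t ⟩
    τ · c + opposite τ · (t - c)       ≡⟨ cong (τ · c +_) (opposite-· τ (t - c)) ⟩
    τ · c + τ · (- (t - c))            ≡⟨ sym (·-+ τ c (- (t - c))) ⟩
    τ · (c - (t - c))                  ∎

  -- Time `c` is spent going out, `c` coming back to the origin and `d` on the other side.
  detour-reaches : ∀ τ {c d} → 0# ≤ c → 0# ≤ d → detour τ c (c + (c + d)) ≡ opposite τ · d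
  detour-reaches τ {c} {d} 0≤c 0≤d = begin
    detour τ c (c + (c + d))           ≡⟨ detour-after τ (0≤x⇒y≤y+x c 0≤c+d) ⟩
    τ · (c - ((c + (c + d)) - c))      ≡⟨ cong (λ a → τ · (c - a)) (x+y-x≡y c (c + d)) ⟩
    τ · (c - (c + d))                  ≡⟨ cong (λ a → τ · (c + a)) (sym (-‿+-comm c d)) ⟩
    τ · (c + (- c - d))                ≡⟨ cong (τ ·_) (x+[-x+y]≡y c (- d)) ⟩
    τ · (- d)                          ≡⟨ sym (opposite-· τ d) ⟩
    opposite τ · d                     ∎
    where
    0≤c+d : 0# ≤ c + d
    0≤c+d = ≤-trans 0≤c (0≤x⇒y≤y+x c 0≤d)

  -- When recalled at `c′ ≤ d`, the squad is at most `d` beyond the origin, so the point `τ · d` is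
  -- at most a further 2d away.
  comeback-reaches : ∀ τ {c c′ d} → 0# ≤ c → c ≤ c′ → c′ ≤ d →
    ∃ λ s → 0# ≤ s × s ≤ d + (d + d) × comeback τ c c′ s ≡ τ · d
  comeback-reaches τ {c} {c′} {d} 0≤c c≤c′ c′≤d =
    s , ≤-trans (≤-trans 0≤c c≤c′) c′≤s , s≤3d , (begin
      comeback τ c c′ s
        ≡⟨ bend-after (detour τ c) τ c′≤s ⟩
      detour τ c c′ + τ · (s - c′)
        ≡⟨ cong₂ (λ a b → a + τ · b) (detour-after τ c≤c′) (x+y-x≡y c′ (d - p)) ⟩
      τ · p + τ · (d - p)
        ≡⟨ sym (·-+ τ p (d - p)) ⟩
      τ · (p + (d - p))
        ≡⟨ cong (τ ·_) (trans (+-comm p (d - p)) ([y-x]+x≡y p d)) ⟩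
      τ · d ∎)
    where
    -- `p` is the coordinate, measured towards `τ`, at the moment of recall; the remaining way is
    -- `d - p`.
    p = c - (c′ - c)
    s = c′ + (d - p)
    0≤c′-c : 0# ≤ c′ - c
    0≤c′-c = x≤y⇒0≤y-x c≤c′
    p≤d : p ≤ d
    p≤d = ≤-trans (0≤x⇒y-x≤y c 0≤c′-c) (≤-trans c≤c′ c′≤d)
    c′≤s : c′ ≤ s
    c′≤s = 0≤x⇒y≤y+x c′ (x≤y⇒0≤y-x p≤d)
    -p≤d : - p ≤ d
    -p≤d = subst (_≤ d) (sym (-‿anti-homo-- c (c′ - c)))
      (≤-trans (0≤x⇒y-x≤y (c′ - c) 0≤c) (≤-trans (0≤x⇒y-x≤y c′ 0≤c) c′≤d))
    s≤3d : s ≤ d + (d + d)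
    s≤3d = +-mono-≤ c′≤d (+-monoʳ-≤ d -p≤d)

-- Ordered message histories and their restriction to earlier times.

module Messages (em : ExcludedMiddle 0ℓ) (R : Reals) {n : ℕ.ℕ} where
  open Reals R
  open Line R
  open Search R

  private variable
    m m′ : Message n
    H H′ : List (Message n)
    s t : ℝ

  Later-asym : ∀ {m m′ : Message n} → Later m m′ → ¬ Later m′ m
  Later-asym (inj₁ m′<m)        (inj₁ m<m′)        = <⇒≱ m′<m (<⇒≤ m<m′)
  Later-asym (inj₁ m′<m)        (inj₂ (m≡m′ , _))  = proj₂ m′<m (sym m≡m′)
  Later-asym (inj₂ (m′≡m , _))  (inj₁ m<m′)        = proj₂ m<m′ (sym m′≡m)
  Later-asym (inj₂ (_ , i<j))   (inj₂ (_ , j<i))   = <-asym i<j j<i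

  Later⇒≤ : Later m m′ → time m′ ≤ time m
  Later⇒≤ (inj₁ m′<m)       = <⇒≤ m′<m
  Later⇒≤ (inj₂ (m′≡m , _)) = reflexive m′≡m

  older : Ordered (m ∷ H) → m′ ∈ₗ m ∷ H → time m′ ≤ time m
  older _           (here refl)  = ≤-refl
  older {m = m} {m′ = m′} (m>H ∷ₚ _) (there m′∈H) = Later⇒≤ {m} {m′} (All.lookup m>H m′∈H)

  -- Were the two heads different, each would occur in the tail of the other list, making each later
  -- than the other.
  Ordered-unique : Ordered H → Ordered H′ → (∀ {m} → m ∈ₗ H → m ∈ₗ H′) →
                   (∀ {m} → m ∈ₗ H′ → m ∈ₗ H) → H ≡ H′
  Ordered-unique {[]}    {[]}     _ _ _ _ = refl
  Ordered-unique {[]}    {_ ∷ _}  _ _ _ H′⊆H with H′⊆H (here refl)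
  ... | ()
  Ordered-unique {_ ∷ _} {[]}     _ _ H⊆H′ _ with H⊆H′ (here refl)
  ... | ()
  Ordered-unique {m ∷ H} {m′ ∷ H′} (m>H ∷ₚ oH) (m′>H′ ∷ₚ oH′) H⊆H′ H′⊆H =
    same-head (H⊆H′ (here refl)) (H′⊆H (here refl))
    where
    tail : m ≡ m′ → m ∷ H ≡ m′ ∷ H′
    tail refl = cong (m ∷_) (Ordered-unique oH oH′
      (λ x∈H → drop m>H x∈H (H⊆H′ (there x∈H)))
      (λ x∈H′ → drop m′>H′ x∈H′ (H′⊆H (there x∈H′))))
      where
      drop : ∀ {K L x} → All (Later m) K → x ∈ₗ K → x ∈ₗ m ∷ L → x ∈ₗ L
      drop m>K x∈K (here refl) = ⊥-elim (Later-asym {m} {m} m>m m>m) where m>m = All.lookup m>K x∈K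
      drop m>K x∈K (there x∈L) = x∈L
    same-head : m ∈ₗ m′ ∷ H′ → m′ ∈ₗ m ∷ H → m ∷ H ≡ m′ ∷ H′
    same-head (here m≡m′)  _            = tail m≡m′
    same-head _            (here m′≡m)  = tail (sym m′≡m)
    same-head (there m∈H′) (there m′∈H) =
      ⊥-elim (Later-asym {m} {m′} (All.lookup m>H m′∈H) (All.lookup m′>H′ m∈H′))

  -- The messages sent after `s` are dropped one by one, newest first; by `causal` none of them
  -- affects the plan at `s`.
  restrict : (A : Algorithm n) → Ordered H → 0# ≤ s → ∃ λ H′ → Ordered H′ ×
             (∀ i → plan A H i s ≡ plan A H′ i s) ×
             (∀ {m} → m ∈ₗ H′ → m ∈ₗ H × time m ≤ s) ×
             (∀ {m} → m ∈ₗ H → time m ≤ s → m ∈ₗ H′)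
  restrict {[]} A oH _ = [] , oH , (λ _ → refl) , (λ ()) , (λ ())
  restrict {m ∷ H} {s} A o@(_ ∷ₚ oH) 0≤s with em {time m ≤ s}
  ... | yes m≤s = m ∷ H , o , (λ _ → refl) ,
                  (λ m′∈ → m′∈ , ≤-trans (older o m′∈) m≤s) , (λ m′∈ _ → m′∈)
  ... | no m≰s with restrict A oH 0≤s
  ...   | H′ , oH′ , same , sound , complete =
    H′ , oH′ , (λ i → trans (causal A o i 0≤s (<⇒≤ (≰⇒> m≰s))) (same i)) ,
    (λ m′∈ → there (proj₁ (sound m′∈)) , proj₂ (sound m′∈)) ,
    λ { (here refl) m≤s → ⊥-elim (m≰s m≤s) ; (there m′∈) → complete m′∈ }

  -- `follows` uses a different history at every instant. This lets the single history heard by `t`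
  -- describe all motion up to `t`.
  plan-heard : ∀ {A : Algorithm n} {f} (r : Run A f) → 0# ≤ s → s ≤ t → ∀ i →
               plan A (heard r t) i s ≡ plan A (heard r s) i s
  plan-heard {s} {t} {A} r 0≤s s≤t i with restrict A (heard-ordered r t) 0≤s
  ... | H , oH , same , sound , complete =
    trans (same i) (cong (λ K → plan A K i s) (Ordered-unique oH (heard-ordered r s)
      (λ {m} m∈H → let m∈ , m≤s = sound m∈H
                       0≤m , _ , rest = to (heard-exactly r t m) m∈
                   in from (heard-exactly r s m) (0≤m , m≤s , rest))
      (λ {m} m∈ → let 0≤m , m≤s , rest = to (heard-exactly r s m) m∈
                  in complete (from (heard-exactly r t m) (0≤m , ≤-trans m≤s s≤t , rest)) m≤s)))

-- The search strategy as a state machine driven by messages.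

data Role : Set where
  fixed mobile : Role

module Strategy (em : ExcludedMiddle 0ℓ) (R : Reals) (k : ℕ.ℕ)
                {n : ℕ.ℕ} (flank : Fin n → Side) (role : Fin n → Role) where
  open Reals R
  open Line R
  open Motion R
  open Search R
  open Messages em R {n}

  abstract
    -- Excluded middle turns any predicate on robots into a subset that has a cardinality.
    ⟦_⟧ : (Fin n → Set) → Subset n
    ⟦ P ⟧ = tabulate (λ i → does (em {P i}))

    ∈⟦⟧⁺ : ∀ {P : Fin n → Set} {i} → P i → i ∈ ⟦ P ⟧
    ∈⟦⟧⁺ {P} {i} p = lookup⇒[]= i ⟦ P ⟧ (trans (lookup∘tabulate _ i) (dec-true em p))

    ∈⟦⟧⁻ : ∀ {P : Fin n → Set} {i} → i ∈ ⟦ P ⟧ → P i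
    ∈⟦⟧⁻ {P} {i} i∈P = extract em (trans (sym (lookup∘tabulate _ i)) ([]=⇒lookup i∈P))
      where
      extract : (P? : Dec (P i)) → does P? ≡ true → P i
      extract (yes p) _ = p

  ⟦⟧-mono : ∀ {P Q : Fin n → Set} → (∀ {i} → P i → Q i) → ⟦ P ⟧ ⊆ ⟦ Q ⟧
  ⟦⟧-mono {P} P⇒Q i∈P = ∈⟦⟧⁺ (P⇒Q (∈⟦⟧⁻ {P} i∈P))

  ⟦⟧-nonempty : ∀ {P : Fin n → Set} → 1 ℕ.≤ ∣ ⟦ P ⟧ ∣ → ∃ P
  ⟦⟧-nonempty {P} 1≤∣P∣ with em {∃ P}
  ... | yes ∃P = ∃P
  ... | no ∄P  = ⊥-elim (ℕₚ.<-irrefl (sym (∣⊥∣≡0 n)) (ℕₚ.≤-trans 1≤∣P∣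
    (p⊆q⇒∣p∣≤∣q∣ {p = ⟦ P ⟧} {∅} (λ i∈P → ⊥-elim (∄P (_ , ∈⟦⟧⁻ {P} i∈P))))))

  private variable
    m : Message n
    H : List (Message n)
    c c′ t : ℝ
    σ τ : Side

  -- An announcement counts only if its time equals its distance, that is, if it is made at the
  -- front of the wing moving outwards at full speed.
  Claims : List (Message n) → Side → ℝ → Fin n → Set
  Claims H σ t i = flank i ≡ σ × message i t (σ · t) ∈ₗ H

  -- Once its mobile squad has turned back, only the fixed squad of a wing is sure to be at the
  -- front.
  FixedClaims : List (Message n) → Side → ℝ → Fin n → Set
  FixedClaims H σ t i = role i ≡ fixed × Claims H σ t i

  claimants fixedClaimants : List (Message n) → Side → ℝ → Subset n
  claimants      H σ t = ⟦ Claims H σ t ⟧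
  fixedClaimants H σ t = ⟦ FixedClaims H σ t ⟧

  -- Fewer than 2k+2 claimants of a wing of 7k+6 cannot be right: the at least
  -- 5k+5 silent ones would all be faulty.
  Trigger : List (Message n) → Side → ℝ → Set
  Trigger H σ t = 0# < t × 2 ℕ.* k ℕ.+ 2 ℕ.≤ ∣ claimants H σ t ∣

  -- If the claim made at time c were true, the wing σ robots silent at c and the
  -- new claimants would all be faulty, which is more than f robots.
  Recall : List (Message n) → Side → ℝ → ℝ → Set
  Recall H σ c t =
    c < t × ∣ claimants H σ c ∣ ℕ.≤ ∣ fixedClaimants H (opposite σ) t ∣ ℕ.+ (k ℕ.+ 1)

  -- turned σ c: the mobile squad opposite to σ left at time c to check the claim
  -- of wing σ; returned σ c c′: it was recalled for good at time c′.
  data State : Set where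
    going    : State
    turned   : Side → ℝ → State
    returned : Side → ℝ → ℝ → State

  advance : List (Message n) → ℝ → State → State
  advance H t going with em {∃ λ σ → Trigger H σ t}
  -- If both wings trigger at the same instant, either may be chosen; `opposite-wing` deals with a
  -- choice away from the target.
  ... | yes (σ , _) = turned σ t
  ... | no _        = going
  advance H t (turned σ c) with em {Recall H σ c t}
  ... | yes _ = returned σ c t
  ... | no _  = turned σ c
  advance H t (returned σ c c′) = returned σ c c′

  -- Testing at the time of the newest message suffices, since a claim counted at `t` is itself a
  -- message sent at `t`.
  state : List (Message n) → State
  state []      = going
  state (m ∷ H) = advance (m ∷ H) (time m) (state H)

  route : State → Side → Role → ℝ → ℝ
  route (turned   left  c)    right mobile = detour right c
  route (turned   right c)    left  mobile = detour left c
  route (returned left  c c′) right mobile = comeback right c c′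
  route (returned right c c′) left  mobile = comeback left c c′
  route _                     σ     _      = straight σ

  -- The invariant of the fold `state`. It describes the state through the whole history, by the
  -- earliest trigger and the earliest recall, so that the correctness proof needs no induction on
  -- messages.
  data Consistent (H : List (Message n)) : State → Set where
    going    : (∀ {σ t} → ¬ Trigger H σ t) → Consistent H going
    turned   : Trigger H σ c → (∀ {τ t} → t < c → ¬ Trigger H τ t) →
               (∀ {t} → ¬ Recall H σ c t) → Consistent H (turned σ c)
    returned : Trigger H σ c → (∀ {τ t} → t < c → ¬ Trigger H τ t) →
               Recall H σ c c′ → (∀ {t} → t < c′ → ¬ Recall H σ c t) →
               Consistent H (returned σ c c′)

  Trigger-heard : Trigger H σ t → ∃ λ i → Claims H σ t i
  Trigger-heard (_ , 2k+2≤) =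
    ⟦⟧-nonempty (ℕₚ.≤-trans (ℕₚ.≤-trans (ℕ.s≤s ℕ.z≤n) (ℕₚ.m≤n+m 2 (2 ℕ.* k))) 2k+2≤)

  Recall-large : Trigger H σ c → Recall H σ c t →
                 k ℕ.+ 1 ℕ.≤ ∣ fixedClaimants H (opposite σ) t ∣
  Recall-large (_ , 2k+2≤) (_ , ≤+k+1) = ℕₚ.+-cancelʳ-≤ (k ℕ.+ 1) _ _
    (ℕₚ.≤-trans (ℕₚ.≤-reflexive (double k)) (ℕₚ.≤-trans 2k+2≤ ≤+k+1))
    where
    double : ∀ k → (k ℕ.+ 1) ℕ.+ (k ℕ.+ 1) ≡ 2 ℕ.* k ℕ.+ 2
    double = solve-∀

  Recall-heard : Trigger H σ c → Recall H σ c t → ∃ λ i → Claims H (opposite σ) t i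
  Recall-heard trigger recall with
    ⟦⟧-nonempty (ℕₚ.≤-trans (ℕₚ.m≤n+m 1 k) (Recall-large trigger recall))
  ... | i , _ , claim = i , claim

  Claims-later : ∀ {i} → Claims H σ t i → Claims (m ∷ H) σ t i
  Claims-later (i∈σ , m∈H) = i∈σ , there m∈H

  -- Counts at times other than that of the new message are frozen; every persistence result for
  -- triggers and recalls rests on this.
  Claims-earlier : ∀ {i} → t ≢ time m → Claims (m ∷ H) σ t i → Claims H σ t i
  Claims-earlier t≢m (i∈σ , here refl)  = ⊥-elim (t≢m refl)
  Claims-earlier t≢m (i∈σ , there m∈H)  = i∈σ , m∈H

  claimants-later : ∣ claimants H σ t ∣ ℕ.≤ ∣ claimants (m ∷ H) σ t ∣
  claimants-later = p⊆q⇒∣p∣≤∣q∣ (⟦⟧-mono Claims-later)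

  claimants-earlier : t ≢ time m → ∣ claimants (m ∷ H) σ t ∣ ℕ.≤ ∣ claimants H σ t ∣
  claimants-earlier t≢m = p⊆q⇒∣p∣≤∣q∣ (⟦⟧-mono (Claims-earlier t≢m))

  Trigger-later : Trigger H σ t → Trigger (m ∷ H) σ t
  Trigger-later (0<t , h) = 0<t , ℕₚ.≤-trans h claimants-later

  Trigger-earlier : t ≢ time m → Trigger (m ∷ H) σ t → Trigger H σ t
  Trigger-earlier t≢m (0<t , h) = 0<t , ℕₚ.≤-trans h (claimants-earlier t≢m)

  -- A further claim at `c` would raise the number that the recall has to match, hence the condition
  -- on `c`.
  Recall-later : c ≢ time m → Recall H σ c t → Recall (m ∷ H) σ c t
  Recall-later c≢m (c<t , h) = c<t , ℕₚ.≤-trans (claimants-earlier c≢m) (ℕₚ.≤-trans h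
    (ℕₚ.+-monoˡ-≤ _ (p⊆q⇒∣p∣≤∣q∣ (⟦⟧-mono λ (x , y) → x , Claims-later y))))

  Recall-earlier : t ≢ time m → Recall (m ∷ H) σ c t → Recall H σ c t
  Recall-earlier t≢m (c<t , h) = c<t , ℕₚ.≤-trans claimants-later (ℕₚ.≤-trans h
    (ℕₚ.+-monoˡ-≤ _ (p⊆q⇒∣p∣≤∣q∣ (⟦⟧-mono λ (x , y) → x , Claims-earlier t≢m y))))

  consistent : Ordered H → Consistent H (state H)
  consistent {[]} _ = going λ trigger → case proj₂ (proj₂ (Trigger-heard trigger)) of λ ()
  consistent {m ∷ H} o@(_ ∷ₚ oH) = step (state H) (consistent oH)
    where
    not-after : ∀ {i σ t} → Claims (m ∷ H) σ t i → ¬ (time m < t)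
    not-after (_ , claim) m<t = <⇒≱ m<t (older o claim)

    ≤m : ∀ {i σ t} → Claims H σ t i → t ≤ time m
    ≤m (_ , claim) = older o (there claim)

    except-m : ∀ {t} {P : ℝ → Set} → ¬ P (time m) → (t ≢ time m → ¬ P t) → ¬ P t
    except-m {t} {P} ¬Pm ¬Pt Pt with em {t ≡ time m}
    ... | yes refl = ¬Pm Pt
    ... | no t≢m   = ¬Pt t≢m Pt

    still-quiet : ∀ {σ c} → Trigger H σ c → (∀ {τ t} → t < c → ¬ Trigger H τ t) →
                  ∀ {τ t} → t < c → ¬ Trigger (m ∷ H) τ t
    -- A claim at `c` was already heard, so `t < c ≤ time m` and the new message does not count at
    -- `t`.
    still-quiet trigger quiet t<c trigger′ = quiet t<c
      (Trigger-earlier (proj₂ (<-≤-trans t<c (≤m (proj₂ (Trigger-heard trigger))))) trigger′)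

    step : ∀ st → Consistent H st → Consistent (m ∷ H) (advance (m ∷ H) (time m) st)
    step going (going quiet) with em {∃ λ σ → Trigger (m ∷ H) σ (time m)}
    ... | yes (σ , trigger) = turned trigger
      (λ t<m trigger′ → quiet (Trigger-earlier (proj₂ t<m) trigger′))
      -- A recall would need a claim after the departure, which is now, at the newest message.
      (λ recall → not-after (proj₂ (Recall-heard trigger recall)) (proj₁ recall))
    ... | no ¬trigger = going λ {σ} → except-m {P = Trigger (m ∷ H) σ}
      (λ trigger → ¬trigger (σ , trigger))
      (λ t≢m trigger → quiet (Trigger-earlier t≢m trigger))
    step (turned σ c) (turned trigger quiet stay) with em {Recall (m ∷ H) σ c (time m)}
    ... | yes recall = returned (Trigger-later trigger)
      (still-quiet trigger quiet)
      recall
      (λ t<m recall′ → stay (Recall-earlier (proj₂ t<m) recall′))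
    ... | no ¬recall = turned (Trigger-later trigger)
      (still-quiet trigger quiet)
      (except-m {P = Recall (m ∷ H) σ c} ¬recall
        (λ t≢m recall → stay (Recall-earlier t≢m recall)))
    step (returned σ c c′) (returned trigger quiet recall stay) =
      returned (Trigger-later trigger)
        (still-quiet trigger quiet)
        (Recall-later (proj₂ (<-≤-trans (proj₁ recall) c′≤m)) recall)
        (λ t<c′ recall′ → stay t<c′ (Recall-earlier (proj₂ (<-≤-trans t<c′ c′≤m)) recall′))
      where
      c′≤m : c′ ≤ time m
      c′≤m = ≤m (proj₂ (Recall-heard trigger recall))

  -- Routes in each state, and causality of the strategy.

  route-fixed : ∀ st σ → route st σ fixed t ≡ σ · t
  route-fixed going            σ     = refl
  route-fixed (turned left _)  left  = refl
  route-fixed (turned left _)  right = refl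
  route-fixed (turned right _) left  = refl
  route-fixed (turned right _) right = refl
  route-fixed (returned left _ _)  left  = refl
  route-fixed (returned left _ _)  right = refl
  route-fixed (returned right _ _) left  = refl
  route-fixed (returned right _ _) right = refl

  route-turned-same : ∀ σ ρ → route (turned σ c) σ ρ t ≡ σ · t
  route-turned-same left  fixed  = refl
  route-turned-same left  mobile = refl
  route-turned-same right fixed  = refl
  route-turned-same right mobile = refl

  route-turned-opposite : ∀ σ → route (turned σ c) (opposite σ) mobile t ≡ detour (opposite σ) c t
  route-turned-opposite left  = refl
  route-turned-opposite right = refl

  route-returned-same : ∀ σ ρ → route (returned σ c c′) σ ρ t ≡ σ · t
  route-returned-same left  fixed  = refl
  route-returned-same left  mobile = refl
  route-returned-same right fixed  = refl
  route-returned-same right mobile = refl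

  route-returned-opposite : ∀ σ → route (returned σ c c′) (opposite σ) mobile t ≡
                                  comeback (opposite σ) c c′ t
  route-returned-opposite left  = refl
  route-returned-opposite right = refl

  route-turned-before : ∀ σ τ ρ → t ≤ c → route (turned σ c) τ ρ t ≡ τ · t
  route-turned-before σ τ fixed  _ = route-fixed (turned σ _) τ
  route-turned-before σ τ mobile t≤c with same-or-opposite σ τ
  ... | inj₁ refl = route-turned-same σ mobile
  ... | inj₂ refl = trans (route-turned-opposite σ) (bend-before _ _ t≤c)

  route-returned-turned : ∀ σ τ ρ → t ≤ c′ →
                          route (returned σ c c′) τ ρ t ≡ route (turned σ c) τ ρ t
  route-returned-turned σ τ fixed  _ =
    trans (route-fixed (returned σ _ _) τ) (sym (route-fixed (turned σ _) τ))
  route-returned-turned σ τ mobile t≤c′ with same-or-opposite σ τ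
  ... | inj₁ refl = trans (route-returned-same σ mobile) (sym (route-turned-same σ mobile))
  ... | inj₂ refl = trans (route-returned-opposite σ)
    (trans (bend-before _ _ t≤c′) (sym (route-turned-opposite σ)))

  route-trajectory : ∀ {st} → Consistent H st → ∀ σ ρ → IsTrajectory (route st σ ρ)
  route-trajectory (going _) σ _ = straight-trajectory σ
  route-trajectory (turned {left} _ _ _)  left  fixed  = straight-trajectory left
  route-trajectory (turned {left} _ _ _)  left  mobile = straight-trajectory left
  route-trajectory (turned {left} _ _ _)  right fixed  = straight-trajectory right
  route-trajectory (turned {left} (0<c , _) _ _) right mobile =
    bend-trajectory left (straight-trajectory right) (<⇒≤ 0<c)
  route-trajectory (turned {right} _ _ _) right fixed  = straight-trajectory right
  route-trajectory (turned {right} _ _ _) right mobile = straight-trajectory right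
  route-trajectory (turned {right} _ _ _) left  fixed  = straight-trajectory left
  route-trajectory (turned {right} (0<c , _) _ _) left mobile =
    bend-trajectory right (straight-trajectory left) (<⇒≤ 0<c)
  route-trajectory (returned {left} _ _ _ _)  left  fixed  = straight-trajectory left
  route-trajectory (returned {left} _ _ _ _)  left  mobile = straight-trajectory left
  route-trajectory (returned {left} _ _ _ _)  right fixed  = straight-trajectory right
  route-trajectory (returned {left} (0<c , _) _ (c<c′ , _) _) right mobile =
    bend-trajectory right (bend-trajectory left (straight-trajectory right) (<⇒≤ 0<c))
      (≤-trans (<⇒≤ 0<c) (<⇒≤ c<c′))
  route-trajectory (returned {right} _ _ _ _) right fixed  = straight-trajectory right
  route-trajectory (returned {right} _ _ _ _) right mobile = straight-trajectory right
  route-trajectory (returned {right} _ _ _ _) left  fixed  = straight-trajectory left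
  route-trajectory (returned {right} (0<c , _) _ (c<c′ , _) _) left mobile =
    bend-trajectory left (bend-trajectory right (straight-trajectory left) (<⇒≤ 0<c))
      (≤-trans (<⇒≤ 0<c) (<⇒≤ c<c′))

  -- Each transition at `T` bends the old course at `T` and leaves the past alone, which is what
  -- `causal` demands.
  advance-before : ∀ {T} st → t ≤ T → ∀ σ ρ → route (advance H T st) σ ρ t ≡ route st σ ρ t
  advance-before {H = H} {T} going t≤T σ ρ with em {∃ λ τ → Trigger H τ T}
  ... | yes (τ , _) = route-turned-before τ σ ρ t≤T
  ... | no _        = refl
  advance-before {H = H} {T} (turned τ c) t≤T σ ρ with em {Recall H τ c T}
  ... | yes _ = route-returned-turned τ σ ρ t≤T
  ... | no _  = refl
  advance-before (returned τ c c′) _ _ _ = refl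

  search : Algorithm n
  search = record
    { plan       = λ H i → route (state H) (flank i) (role i)
    ; trajectory = λ oH i → route-trajectory (consistent oH) (flank i) (role i)
    ; causal     = λ {m} {H} _ i _ t≤m → advance-before (state H) t≤m (flank i) (role i)
    }

  -- What a history reveals about targets and faults.

  wing : Side → Subset n
  wing σ = ⟦ (λ i → flank i ≡ σ) ⟧

  squad : Side → Role → Subset n
  squad σ ρ = ⟦ (λ i → flank i ≡ σ × role i ≡ ρ) ⟧

  -- What the messages H heard up to time T, and hence the state st they lead
  -- to, say if the target is x and the faulty robots are F.
  record Testimony (H : List (Message n)) (st : State) (T x : ℝ) (F : Subset n) : Set where
    field
      few     : ∣ F ∣ ℕ.≤ 5 ℕ.* k ℕ.+ 4
      recent  : ∀ {m} → m ∈ₗ H → time m ≤ T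
      paced   : ∀ {i s σ d} → message i s (σ · d) ∈ₗ H → d ≤ s
      honest  : ∀ {m} → m ∈ₗ H → sender m ∉ F → location m ≡ x
      reports : ∀ {i s} → i ∉ F → 0# ≤ s → s ≤ T → route st (flank i) (role i) s ≡ x →
                ∃ λ s′ → s′ ≤ s × message i s′ x ∈ₗ H

  testimony : (r : Run search (5 ℕ.* k ℕ.+ 4)) → ∀ T →
              Testimony (heard r T) (state (heard r T)) T (target r) (faulty r)
  testimony r T = record
    { few     = faulty≤f r
    ; recent  = λ m∈H → proj₁ (proj₂ (to (heard-exactly r T _) m∈H))
    ; paced   = λ {_} {_} {σ} m∈H → let 0≤s , _ , _ , at = to (heard-exactly r T _) m∈H in
                distance≤time (moves r _) {σ = σ} 0≤s (sym at)
    ; honest  = λ m∈H i∉F → let 0≤s , _ , announced , at = to (heard-exactly r T _) m∈H in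
                trans at (truthful r i∉F 0≤s announced)
    ; reports = λ i∉F 0≤s s≤T at-x →
        -- `plan-heard` replaces the messages heard by `s`, of which `follows` speaks, by those
        -- heard by `T`.
        let s′ , 0≤s′ , s′≤s , announced = reports r i∉F 0≤s
              (trans (follows r i∉F 0≤s) (trans (sym (plan-heard r 0≤s s≤T _)) at-x))
        in s′ , s′≤s , from (heard-exactly r T _)
             (0≤s′ , ≤-trans s′≤s s≤T , announced , sym (truthful r i∉F 0≤s′ announced))
    }

  private variable
    st : State
    T x y d e : ℝ
    F F′ : Subset n
    υ : Side

  open Testimony

  refuted : Testimony H st T x F → σ · t ≢ x → claimants H σ t ⊆ F
  refuted {F = F} W σ·t≢x {i} i∈ with i ∈? F
  ... | yes i∈F = i∈F
  ... | no i∉F  = ⊥-elim (σ·t≢x (honest W (proj₂ (∈⟦⟧⁻ i∈)) i∉F))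

  fixedClaimants⊆claimants : fixedClaimants H σ t ⊆ claimants H σ t
  fixedClaimants⊆claimants {H} {σ} {t} = ⟦⟧-mono {FixedClaims H σ t} proj₂

  -- Nobody can be at σ · d earlier than at time d.
  prompt : Testimony H st T (σ · d) F → 0# ≤ d → d ≤ T → ∀ {i} → flank i ≡ σ →
           route st (flank i) (role i) d ≡ σ · d → i ∉ F → Claims H σ d i
  prompt {H} {σ = σ} W 0≤d d≤T {i} i∈σ at i∉F with reports W i∉F 0≤d d≤T at
  ... | s , s≤d , m∈H with antisym s≤d (paced W {σ = σ} m∈H)
  ...   | refl = i∈σ , m∈H

  wing⊆claimants∪F : Testimony H st T (σ · d) F → 0# ≤ d → d ≤ T →
                     (∀ ρ → route st σ ρ d ≡ σ · d) → wing σ ⊆ claimants H σ d ∪ F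
  wing⊆claimants∪F {F = F} W 0≤d d≤T at {i} i∈wing with ∈⟦⟧⁻ i∈wing | i ∈? F
  ... | _    | yes i∈F = x∈p∪q⁺ (inj₂ i∈F)
  ... | refl | no i∉F  = x∈p∪q⁺ (inj₁ (∈⟦⟧⁺ (prompt W 0≤d d≤T refl (at _) i∉F)))

  fixed⊆fixedClaimants∪F : Testimony H st T (σ · d) F → 0# ≤ d → d ≤ T →
                           squad σ fixed ⊆ fixedClaimants H σ d ∪ F
  fixed⊆fixedClaimants∪F {st = st} {σ = σ} {F = F} W 0≤d d≤T {i} i∈squad with ∈⟦⟧⁻ i∈squad | i ∈? F
  ... | _           | yes i∈F = x∈p∪q⁺ (inj₂ i∈F)
  ... | refl , i∈fx | no i∉F  = x∈p∪q⁺ (inj₁ (∈⟦⟧⁺ (i∈fx , prompt W 0≤d d≤T refl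
    (trans (cong (λ ρ → route st σ ρ _) i∈fx) (route-fixed st σ)) i∉F)))

  -- A visitor of `x` outside `F` must announce `x`, and outside `F′` it must not, as the target
  -- there is `y`.
  visitor-suspect : Testimony H st T x F → Testimony H st T y F′ → x ≢ y →
    ∀ {i s} → 0# ≤ s → s ≤ T → route st (flank i) (role i) s ≡ x → i ∈ F ∪ F′
  visitor-suspect {F = F} {F′ = F′} W W′ x≢y {i} 0≤s s≤T at with i ∈? F | i ∈? F′
  ... | yes i∈F | _        = x∈p∪q⁺ (inj₁ i∈F)
  ... | no _    | yes i∈F′ = x∈p∪q⁺ (inj₂ i∈F′)
  ... | no i∉F  | no i∉F′ with reports W i∉F 0≤s s≤T at
  ...   | s′ , _ , m∈H = ⊥-elim (x≢y (honest W′ m∈H i∉F′))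

  side-apart : ∀ {σ τ} → σ ≢ τ → 0# < c → 0# < d → σ · c ≢ τ · d
  side-apart {σ = σ} {τ = τ} σ≢τ 0<c 0<d eq = σ≢τ (proj₁ (·-injective {σ} {τ} 0<c 0<d eq))

  time-apart : ∀ {σ τ} → 0# < c → c < d → σ · c ≢ τ · d
  time-apart {σ = σ} {τ = τ} 0<c c<d eq =
    proj₂ c<d (proj₂ (·-injective {σ} {τ} 0<c (≤-<-trans (<⇒≤ 0<c) c<d) eq))

  wings-disjoint : ∀ {i} → σ ≢ τ → i ∈ wing σ → i ∉ wing τ
  wings-disjoint σ≢τ i∈σ i∈τ = σ≢τ (trans (sym (∈⟦⟧⁻ i∈σ)) (∈⟦⟧⁻ i∈τ))

  claimants⊆wing : claimants H σ t ⊆ wing σ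
  claimants⊆wing {H} {σ} {t} = ⟦⟧-mono {Claims H σ t} proj₁

  squad⊆wing : ∀ {ρ} → squad σ ρ ⊆ wing σ
  squad⊆wing {σ} {ρ} = ⟦⟧-mono {λ i → flank i ≡ σ × role i ≡ ρ} proj₁

  -- Common ground of `turned` and `returned`: everything that does not depend on a later recall.
  record Departed (H : List (Message n)) (st : State) (σ : Side) (c : ℝ) : Set where
    field
      trigger : Trigger H σ c
      quiet   : ∀ {τ t} → t < c → ¬ Trigger H τ t
      same    : ∀ {t} ρ → route st σ ρ t ≡ σ · t
      before  : ∀ {t} τ ρ → t ≤ c → route st τ ρ t ≡ τ · t

  open Departed

  turned-departed : Consistent H (turned σ c) → Departed H (turned σ c) σ c
  turned-departed (turned {σ} trigger quiet _) = record
    { trigger = trigger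
    ; quiet   = quiet
    ; same    = route-turned-same σ
    ; before  = route-turned-before σ
    }

  returned-departed : Consistent H (returned σ c c′) → Departed H (returned σ c c′) σ c
  returned-departed (returned {σ} trigger quiet (c<c′ , _) _) = record
    { trigger = trigger
    ; quiet   = quiet
    ; same    = route-returned-same σ
    ; before  = λ τ ρ t≤c → trans (route-returned-turned σ τ ρ (≤-trans t≤c (<⇒≤ c<c′)))
                              (route-turned-before σ τ ρ t≤c)
    }

  -- Correctness: the target is visited by a reliable robot, and no other target fits.

  module Correctness
    (fixed-large  : ∀ σ → 4 ℕ.* k ℕ.+ 3 ℕ.≤ ∣ squad σ fixed ∣)
    (mobile-large : ∀ σ → 3 ℕ.* k ℕ.+ 3 ℕ.≤ ∣ squad σ mobile ∣) where
    open Cardinality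
    open Arithmetic k

    wing-large : ∀ σ → 7 ℕ.* k ℕ.+ 6 ℕ.≤ ∣ wing σ ∣
    wing-large σ = ℕₚ.≤-trans (ℕₚ.≤-reflexive (sym 4k+3+3k+3≡7k+6))
      (ℕₚ.≤-trans (fixed-large σ ⊕ mobile-large σ)
        (disjoint⇒∣p∣+∣q∣≤∣r∣ (squad σ fixed) (squad σ mobile) (wing σ) apart
          (squad⊆wing {σ} {fixed}) (squad⊆wing {σ} {mobile})))
      where
      apart : ∀ {i} → i ∈ squad σ fixed → i ∉ squad σ mobile
      apart i∈fx i∈mb with trans (sym (proj₂ (∈⟦⟧⁻ i∈fx))) (proj₂ (∈⟦⟧⁻ i∈mb))
      ... | ()

    -- All reliable robots of the wing announce at time `d`, and there are at least 2k + 2 of them.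
    wing-triggers : Testimony H st T (σ · d) F → 0# < d → d ≤ T →
                    (∀ ρ → route st σ ρ d ≡ σ · d) → Trigger H σ d
    -- `v = 0`: there is no false claim to be outnumbered here.
    wing-triggers {H = H} {σ = σ} {d = d} {F = F} W 0<d d≤T at = 0<d , outnumber {v = 0} (wing-large σ)
      (ℕₚ.≤-trans (ℕₚ.≤-reflexive (ℕₚ.+-identityʳ _))
        (p⊆q∪r⇒∣p∣≤∣q∣+∣r∣ (wing σ) (claimants H σ d) F (wing⊆claimants∪F W (<⇒≤ 0<d) d≤T at)))
      (few W)

    -- Until `c` both wings go straight out, so a target nearer than `c` would have triggered first.
    departure-≤ : Departed H st σ c → Testimony H st T (τ · d) F → 0# < d → d ≤ T → c ≤ d
    departure-≤ {c = c} {τ = τ} {d = d} D W 0<d d≤T with em {c ≤ d}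
    ... | yes c≤d = c≤d
    ... | no c≰d  = ⊥-elim (quiet D (≰⇒> c≰d)
      (wing-triggers W 0<d d≤T (λ ρ → before D τ ρ (<⇒≤ (≰⇒> c≰d)))))

    -- Otherwise all robots at the target at time `d` are faulty. They form a whole wing, or else a
    -- fixed squad, in which case the at least 2k + 2 claimants that lured its mobile squad away are
    -- faulty too.
    visitor : Testimony H st T (τ · d) F → Consistent H st → 0# < d → d ≤ T →
      ∃ λ i → i ∉ F × ∃ λ s → 0# ≤ s × s ≤ T × route st (flank i) (role i) s ≡ τ · d
    visitor {H = H} {st} {T} {τ} {d} {F} W C 0<d d≤T with
      em {∃ λ i → i ∉ F × ∃ λ s → 0# ≤ s × s ≤ T × route st (flank i) (role i) s ≡ τ · d}
    ... | yes v = v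
    ... | no ¬v = ⊥-elim (impossible C)
      where
      faulty-visitor : ∀ {i} → route st (flank i) (role i) d ≡ τ · d → i ∈ F
      faulty-visitor {i} at with i ∈? F
      ... | yes i∈F = i∈F
      ... | no i∉F  = ⊥-elim (¬v (i , i∉F , d , <⇒≤ 0<d , d≤T , at))

      wing-there : (∀ ρ → route st τ ρ d ≡ τ · d) → ⊥
      wing-there at = wing-exceeds (wing-large τ) (p⊆q⇒∣p∣≤∣q∣ {p = wing τ} {F} wing⊆F) (few W)
        where
        wing⊆F : wing τ ⊆ F
        wing⊆F {i} i∈wing with ∈⟦⟧⁻ i∈wing
        ... | refl = faulty-visitor (at (role i))

      squad⊆F : squad τ fixed ⊆ F
      squad⊆F {i} i∈squad with ∈⟦⟧⁻ i∈squad
      ... | refl , i∈fx = faulty-visitor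
        (trans (cong (λ ρ → route st (flank i) ρ d) i∈fx) (route-fixed st (flank i)))

      departed : Departed H st σ c → ⊥
      departed {σ} {c} D with em {d ≤ c} | same-or-opposite σ τ
      ... | yes d≤c | _         = wing-there (λ ρ → before D τ ρ d≤c)
      ... | no _    | inj₁ refl = wing-there (same D)
      ... | no d≰c  | inj₂ refl = squad-exceeds (fixed-large τ) (proj₂ (trigger D))
        (disjoint⇒∣p∣+∣q∣≤∣r∣ (squad τ fixed) (claimants H σ c) F
          (λ i∈fx i∈cl → wings-disjoint (opposite-≢ σ) (squad⊆wing {ρ = fixed} i∈fx)
                                        (claimants⊆wing i∈cl))
          squad⊆F (refuted {σ = σ} {t = c} W (time-apart {σ = σ} {τ = τ} (proj₁ (trigger D)) (≰⇒> d≰c))))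
        (few W)

      impossible : Consistent H st → ⊥
      impossible (going quiet)    = wing-there (λ _ → refl)
      impossible C@(turned _ _ _) = departed (turned-departed C)
      impossible C@(returned _ _ _ _) = departed (returned-departed C)

    -- Two scenarios with different targets and the same messages, the first target being no farther
    -- than the second.

    module _ (W : Testimony H st T (τ · d) F) (W′ : Testimony H st T (υ · e) F′)
             (0<d : 0# < d) (d≤e : d ≤ e) (3d≤T : d + (d + d) ≤ T)
             (x≢y : τ · d ≢ υ · e) where

      0≤d : 0# ≤ d
      0≤d = <⇒≤ 0<d

      0<e : 0# < e
      0<e = <-≤-trans 0<d d≤e

      d≤T : d ≤ T
      d≤T = ≤-trans (0≤x⇒y≤y+x d (≤-trans 0≤d (0≤x⇒y≤y+x d 0≤d))) 3d≤T

      budget : ∣ F ∪ F′ ∣ ℕ.+ ∣ F ∩ F′ ∣ ℕ.≤ (5 ℕ.* k ℕ.+ 4) ℕ.+ (5 ℕ.* k ℕ.+ 4)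
      budget = ℕₚ.≤-trans (ℕₚ.≤-reflexive (∣p∪q∣+∣p∩q∣≡∣p∣+∣q∣ F F′)) (few W ⊕ few W′)

      suspect : ∀ {i s} → 0# ≤ s → s ≤ T → route st (flank i) (role i) s ≡ τ · d → i ∈ F ∪ F′
      suspect = visitor-suspect W W′ x≢y

      suspect′ : ∀ {i s} → 0# ≤ s → s ≤ T → route st (flank i) (role i) s ≡ υ · e → i ∈ F ∪ F′
      suspect′ 0≤s s≤T at =
        subst (_ ∈_) (∪-comm F′ F) (visitor-suspect W′ W (λ y≡x → x≢y (sym y≡x)) 0≤s s≤T at)

      wing-suspect : (∀ ρ → route st τ ρ d ≡ τ · d) → wing τ ⊆ F ∪ F′
      wing-suspect at {i} i∈wing with ∈⟦⟧⁻ i∈wing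
      ... | refl = suspect 0≤d d≤T (at (role i))

      both-refuted : σ · t ≢ τ · d → σ · t ≢ υ · e → claimants H σ t ⊆ F ∩ F′
      both-refuted {σ} {t} t≢x t≢y i∈ = x∈p∩q⁺ (refuted {σ = σ} {t = t} W t≢x i∈ , refuted {σ = σ} {t = t} W′ t≢y i∈)

      -- The wing at the target would trigger at time d as well; two such claims,
      -- at most one of them true, imply too many faults.
      opposite-wing : Departed H st σ d → τ ≢ opposite σ
      opposite-wing {σ} D refl = conclude (em {σ · d ≡ υ · e})
        where
        apart : ∀ {i} → i ∈ wing τ → i ∉ claimants H σ d
        apart i∈ i∈cl = wings-disjoint (opposite-≢ σ) i∈ (claimants⊆wing i∈cl)
        σd≢x : σ · d ≢ τ · d
        σd≢x = side-apart {σ = σ} {τ = τ} (λ σ≡τ → opposite-≢ σ (sym σ≡τ)) 0<d 0<d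
        v+2k+2≤v′ : ∣ claimants H σ d ∣ ℕ.+ (2 ℕ.* k ℕ.+ 2) ℕ.≤ ∣ claimants H τ d ∣
        v+2k+2≤v′ = outnumber (wing-large τ)
          (disjoint⇒∣p∣+∣q∣≤∣r∣+∣s∣ (wing τ) (claimants H σ d) (claimants H τ d) F apart
            (wing⊆claimants∪F W 0≤d d≤T (λ ρ → before D τ ρ ≤-refl))
            (λ i∈ → x∈p∪q⁺ (inj₂ (refuted {σ = σ} {t = d} W σd≢x i∈))))
          (few W)
        conclude : Dec (σ · d ≡ υ · e) → ⊥
        conclude (yes σd≡y) with ·-injective {σ} {υ} 0<d 0<e σd≡y
        ... | refl , refl = outnumber-asym v+2k+2≤v′ (outnumber (wing-large σ)
          (disjoint⇒∣p∣+∣q∣≤∣r∣+∣s∣ (wing σ) (claimants H τ d) (claimants H σ d) F′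
            (λ i∈σ i∈cl → wings-disjoint (opposite-≢ σ) (claimants⊆wing i∈cl) i∈σ)
            (wing⊆claimants∪F W′ 0≤d d≤T (same D))
            (λ i∈ → x∈p∪q⁺ (inj₂ (refuted {σ = τ} {t = d} W′ x≢y i∈))))
          (few W′))
        conclude (no σd≢y) = two-claims-exceed (proj₂ (trigger D)) v+2k+2≤v′
          (disjoint⇒∣p∣+∣q∣≤∣r∣ (claimants H σ d) (claimants H τ d) F′
            (λ i∈cl i∈cl′ → apart (claimants⊆wing i∈cl′) i∈cl)
            (refuted {σ = σ} {t = d} W′ σd≢y) (refuted {σ = τ} {t = d} W′ x≢y))
          (few W′)

      -- The claim at `c` is false, so its claimants and the silent robots of the fixed squad at the
      -- target share at most f faults.
      recall-due : ∀ {σ} → Departed H st σ c → τ ≡ opposite σ → c < d → Recall H σ c d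
      recall-due {c} {σ} D refl c<d = c<d , recalls (fixed-large τ)
        (disjoint⇒∣p∣+∣q∣≤∣r∣+∣s∣ (squad τ fixed) (claimants H σ c) (fixedClaimants H τ d) F
          (λ i∈fx i∈cl → wings-disjoint (opposite-≢ σ) (squad⊆wing {ρ = fixed} i∈fx)
                                        (claimants⊆wing i∈cl))
          (fixed⊆fixedClaimants∪F W 0≤d d≤T)
          (λ i∈ → x∈p∪q⁺ (inj₂
            (refuted {σ = σ} {t = c} W (time-apart {σ = σ} {τ = τ} (proj₁ (trigger D)) c<d) i∈))))
        (few W)

      -- Both targets are at distance at least `d`.
      both-refuted-early : ∀ {σ} → 0# < t → t < d → claimants H σ t ⊆ F ∩ F′
      both-refuted-early {t} {σ} 0<t t<d = both-refuted {σ} {t}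
        (time-apart {σ = σ} {τ = τ} 0<t t<d)
        (time-apart {σ = σ} {τ = υ} 0<t (<-≤-trans t<d d≤e))

      wing+squad : ∀ {σ} → (∀ ρ → route st τ ρ d ≡ τ · d) → ∀ ρ → τ ≢ σ →
                   squad σ ρ ⊆ F ∪ F′ → ∣ wing τ ∣ ℕ.+ ∣ squad σ ρ ∣ ℕ.≤ ∣ F ∪ F′ ∣
      wing+squad {σ} at ρ τ≢σ = disjoint⇒∣p∣+∣q∣≤∣r∣ (wing τ) (squad σ ρ) (F ∪ F′)
        (λ i∈τ i∈sq → wings-disjoint τ≢σ i∈τ (squad⊆wing {ρ = ρ} i∈sq)) (wing-suspect at)

      -- The other wing's mobile squad reaches the target at `d + 2c`, at most `3d`. With the wing
      -- already there this makes 10k + 9 visitors, all in `F ∪ F′`.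
      turned-same : Consistent H st → st ≡ turned τ c → c ≤ d → ⊥
      turned-same {c} C refl c≤d =
        two-runs-exceed (wing-large τ)
          (wing+squad (same D) mobile (λ τ≡ → opposite-≢ τ (sym τ≡)) squad⊆)
          ℕ.z≤n
          (ℕₚ.≤-trans (mobile-large (opposite τ)) (ℕₚ.≤-reflexive (sym (ℕₚ.+-identityʳ _))))
          budget
        where
        D = turned-departed C
        0≤c = <⇒≤ (proj₁ (trigger D))
        squad⊆ : squad (opposite τ) mobile ⊆ F ∪ F′
        squad⊆ {i} i∈squad with ∈⟦⟧⁻ i∈squad
        ... | i∈τ′ , i∈mb = suspect {s = c + (c + d)}
          (≤-trans 0≤c (0≤x⇒y≤y+x c (≤-trans 0≤c (0≤x⇒y≤y+x c 0≤d))))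
          (≤-trans (+-mono-≤ c≤d (+-monoˡ-≤ d c≤d)) 3d≤T)
          (trans (cong₂ (λ σ ρ → route (turned τ c) σ ρ (c + (c + d))) i∈τ′ i∈mb)
            (trans (route-turned-opposite τ)
              (trans (detour-reaches (opposite τ) 0≤c 0≤d)
                (cong (_· d) (opposite-involutive τ)))))

      returned-same : Consistent H st → st ≡ returned τ c c′ → c ≤ d → ⊥
      returned-same {c} {c′} C@(returned trig _ recall _) refl c≤d =
        conclude (em {c ≡ d}) (em {opposite τ · c′ ≡ υ · e})
        where
        D = returned-departed C
        τ≢τ′ : τ ≢ opposite τ
        τ≢τ′ τ≡ = opposite-≢ τ (sym τ≡)
        0<c′ : 0# < c′
        0<c′ = <-≤-trans (proj₁ trig) (<⇒≤ (proj₁ recall))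
        c′≢x : opposite τ · c′ ≢ τ · d
        c′≢x = side-apart {σ = opposite τ} {τ = τ} (opposite-≢ τ) 0<c′ 0<d
        fixedClaimants⊆wing : fixedClaimants H (opposite τ) c′ ⊆ wing (opposite τ)
        fixedClaimants⊆wing i∈ = claimants⊆wing (fixedClaimants⊆claimants i∈)
        conclude : Dec (c ≡ d) → Dec (opposite τ · c′ ≡ υ · e) → ⊥
        -- The first claim is true for `F`, so the silent robots of its wing and the fixed claimants
        -- that caused the recall are all in `F`.
        conclude (yes refl) _ = recall-exceeds (wing-large τ)
          (disjoint⇒∣p∣+∣q∣≤∣r∣+∣s∣
            (wing τ) (fixedClaimants H (opposite τ) c′) (claimants H τ d) F
            (λ i∈τ i∈fc → wings-disjoint τ≢τ′ i∈τ (fixedClaimants⊆wing i∈fc))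
            (wing⊆claimants∪F W 0≤d d≤T (same D))
            (λ i∈ → x∈p∪q⁺ (inj₂ (refuted {σ = opposite τ} {t = c′} W c′≢x (fixedClaimants⊆claimants i∈)))))
          (proj₂ recall) (few W)
        -- The recalling claim is made at the second target: the fixed squad that passes it and the
        -- wing that passes the first target are all suspect.
        conclude (no _) (yes c′≡y) =
          two-runs-exceed (wing-large τ) (wing+squad (same D) fixed τ≢τ′ squad⊆) ℕ.z≤n
            (ℕₚ.≤-trans (ℕₚ.≤-trans 3k+3≤4k+3 (fixed-large (opposite τ)))
                        (ℕₚ.≤-reflexive (sym (ℕₚ.+-identityʳ _))))
            budget
          where
          squad⊆ : squad (opposite τ) fixed ⊆ F ∪ F′
          squad⊆ {i} i∈squad with ∈⟦⟧⁻ i∈squad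
          ... | i∈τ′ , i∈fx = suspect′ {s = c′} (<⇒≤ 0<c′)
            -- `c′ ≤ T`, because a claim made at `c′` has been heard.
            (recent W (proj₂ (proj₂ (Recall-heard trig recall))))
            (trans (cong₂ (λ σ ρ → route (returned τ c c′) σ ρ c′) i∈τ′ i∈fx)
              (trans (route-fixed (returned τ c c′) (opposite τ)) c′≡y))
        -- At least k + 1 fixed claimants join the wing in the union, and the at least 2k + 2
        -- claimants at `c` lie in the intersection.
        conclude (no c≢d) (no c′≢y) = two-runs-exceed (wing-large τ)
          (disjoint⇒∣p∣+∣q∣≤∣r∣ (wing τ) (fixedClaimants H (opposite τ) c′) (F ∪ F′)
            (λ i∈τ i∈fc → wings-disjoint τ≢τ′ i∈τ (fixedClaimants⊆wing i∈fc))
            (wing-suspect (same D))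
            (λ i∈ → x∈p∪q⁺ (inj₁ (refuted {σ = opposite τ} {t = c′} W c′≢x (fixedClaimants⊆claimants i∈)))))
          (p⊆q⇒∣p∣≤∣q∣ {p = claimants H τ c} {F ∩ F′} (both-refuted-early (proj₁ trig) (c≤d , c≢d)))
          (ℕₚ.≤-trans 3k+3≤[k+1]+[2k+2] (Recall-large trig recall ⊕ proj₂ trig))
          budget

      -- A recall is due by time `d`, so the mobile squad comes back to the target by `3d` and the
      -- whole wing `τ` is suspect.
      returned-opposite : ∀ {σ} → Consistent H st → st ≡ returned σ c c′ → τ ≡ opposite σ → c < d → ⊥
      returned-opposite {c} {c′} {σ} C@(returned trig _ recall stay) refl refl c<d =
        two-runs-exceed (wing-large τ)
          (disjoint⇒∣p∣+∣q∣≤∣r∣ (wing τ) (claimants H σ c) (F ∪ F′)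
            (λ i∈ i∈cl → wings-disjoint (opposite-≢ σ) i∈ (claimants⊆wing i∈cl))
            wing⊆
            (λ i∈ → x∈p∪q⁺ (inj₁ (proj₁ (x∈p∩q⁻ F F′ (refuted² i∈))))))
          (p⊆q⇒∣p∣≤∣q∣ {p = claimants H σ c} {F ∩ F′} refuted²)
          -- The same claimants at `c` count twice, in the union and in the intersection.
          (ℕₚ.≤-trans 3k+3≤[k+1]+[2k+2] (ℕₚ.≤-trans k+1≤2k+2 (proj₂ trig) ⊕ proj₂ trig))
          budget
        where
        refuted² : claimants H σ c ⊆ F ∩ F′
        refuted² = both-refuted-early (proj₁ trig) c<d
        c′≤d : c′ ≤ d
        c′≤d with em {c′ ≤ d}
        ... | yes c′≤d = c′≤d
        ... | no c′≰d  = ⊥-elim (stay (≰⇒> c′≰d) (recall-due (returned-departed C) refl c<d))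
        wing⊆ : wing τ ⊆ F ∪ F′
        wing⊆ {i} i∈wing with role i in i∈ρ
        ... | fixed = suspect 0≤d d≤T
          (trans (cong₂ (λ υ ρ → route (returned σ c c′) υ ρ d) (∈⟦⟧⁻ i∈wing) i∈ρ)
                 (route-fixed (returned σ c c′) τ))
        ... | mobile with comeback-reaches τ (<⇒≤ (proj₁ trig)) (<⇒≤ (proj₁ recall)) c′≤d
        ...   | s , 0≤s , s≤3d , at = suspect 0≤s (≤-trans s≤3d 3d≤T)
          (trans (cong₂ (λ υ ρ → route (returned σ c c′) υ ρ s) (∈⟦⟧⁻ i∈wing) i∈ρ)
                 (trans (route-returned-opposite σ) at))

      contradictory : Consistent H st → ⊥
      contradictory (going quiet) = quiet (wing-triggers {σ = τ} W 0<d d≤T (λ _ → refl))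
      contradictory C@(turned {σ} {c} _ _ stay) with
        departure-≤ {τ = τ} (turned-departed C) W 0<d d≤T | same-or-opposite σ τ | em {c ≡ d}
      ... | c≤d | inj₁ refl | _        = turned-same C refl c≤d
      ... | _   | inj₂ refl | yes refl = opposite-wing (turned-departed C) refl
      ... | c≤d | inj₂ refl | no c≢d   = stay (recall-due (turned-departed C) refl (c≤d , c≢d))
      contradictory C@(returned {σ} {c} _ _ _ _) with
        departure-≤ {τ = τ} (returned-departed C) W 0<d d≤T | same-or-opposite σ τ | em {c ≡ d}
      ... | c≤d | inj₁ refl | _        = returned-same C refl c≤d
      ... | _   | inj₂ refl | yes refl = opposite-wing (returned-departed C) refl
      ... | c≤d | inj₂ refl | no c≢d   = returned-opposite C refl refl (c≤d , c≢d)

    search-time : ∀ d → 0# < d → SearchTime≤ search (5 ℕ.* k ℕ.+ 4) d (fromℕ 3 * d)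
    search-time d 0<d r target≡±d = 3d , 0≤3d , ≤-refl , found , certain
      where
      3d = fromℕ 3 * d
      3·≤3d : ∀ {e} → e ≤ d → e + (e + e) ≤ 3d
      3·≤3d e≤d = ≤-trans (+-mono-≤ e≤d (+-mono-≤ e≤d e≤d)) (reflexive (sym (3*x≡x+[x+x] d)))
      d≤3d : d ≤ 3d
      d≤3d = ≤-trans (0≤x⇒y≤y+x d (≤-trans (<⇒≤ 0<d) (0≤x⇒y≤y+x d (<⇒≤ 0<d)))) (3·≤3d ≤-refl)
      0≤3d : 0# ≤ 3d
      0≤3d = ≤-trans (<⇒≤ 0<d) d≤3d

      polar : ∃ λ σ → target r ≡ σ · d
      polar = [ (right ,_) , (left ,_) ]′ target≡±d
      side = proj₁ polar

      C : Consistent (heard r 3d) (state (heard r 3d))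
      C = consistent (heard-ordered r 3d)

      W : Testimony (heard r 3d) (state (heard r 3d)) 3d (side · d) (faulty r)
      W = subst (λ x → Testimony (heard r 3d) (state (heard r 3d)) 3d x (faulty r)) (proj₂ polar) (testimony r 3d)

      found : FoundByReliable r 3d
      found with visitor {τ = side} W C 0<d d≤3d
      ... | i , i∉F , s , 0≤s , s≤3d , at with
        Run.reports r i∉F 0≤s (trans (follows r i∉F 0≤s)
          (trans (sym (plan-heard r 0≤s s≤3d i)) (trans at (sym (proj₂ polar)))))
      ...   | s′ , 0≤s′ , s′≤s , announced =
        i , i∉F , s′ , 0≤s′ , ≤-trans s′≤s s≤3d , truthful r i∉F 0≤s′ announced , announced

      certain : Certain r 3d
      certain r′ heard≡ with em {target r′ ≡ target r}
      ... | yes y≡x = y≡x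
      ... | no y≢x with ·-polar (target r′) (target≢0 r′)
      ...   | υ , e , 0<e , y≡υ·e = ⊥-elim (refute (total d e))
        where
        W′ : Testimony (heard r 3d) (state (heard r 3d)) 3d (υ · e) (faulty r′)
        W′ = subst₂ (λ H y → Testimony H (state H) 3d y (faulty r′)) heard≡ y≡υ·e (testimony r′ 3d)
        x≢y′ : side · d ≢ υ · e
        x≢y′ x≡y = y≢x (trans y≡υ·e (trans (sym x≡y) (sym (proj₂ polar))))
        refute : d ≤ e ⊎ e ≤ d → ⊥
        -- The nearer of the two targets takes the leading part, whichever scenario it belongs to.
        refute (inj₁ d≤e) = contradictory {τ = side} {υ = υ} W W′ 0<d d≤e (3·≤3d ≤-refl) x≢y′ C
        refute (inj₂ e≤d) = contradictory {τ = υ} {υ = side} W′ W 0<e e≤d (3·≤3d e≤d) (λ y≡x → x≢y′ (sym y≡x)) C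

-- Division of the robots into four squads.

module Formation where
  open ℕ using (ℕ; suc; _+_; _*_; _≤_)

  private variable
    A : Set
    m n : ℕ

  module _ {P : A → Set} (P? : ∀ x → Dec (P x)) where

    count≤∣∣ : (xs : Vec A n) (p : Subset n) → (∀ i → P (lookup xs i) → i ∈ p) →
               count P? xs ≤ ∣ p ∣
    count≤∣∣ []       []          _ = ℕ.z≤n
    count≤∣∣ (x ∷ xs) (b ∷ p) P⇒∈ with P? x
    count≤∣∣ (x ∷ xs) (true ∷ p)  P⇒∈ | yes _ =
      ℕ.s≤s (count≤∣∣ xs p λ i Pi → drop-there (P⇒∈ (Fin.suc i) Pi))
    count≤∣∣ (x ∷ xs) (false ∷ p) P⇒∈ | yes Px with P⇒∈ Fin.zero Px
    ... | ()
    count≤∣∣ (x ∷ xs) (b ∷ p) P⇒∈ | no _ = ℕₚ.≤-trans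
      (count≤∣∣ xs p λ i Pi → drop-there (P⇒∈ (Fin.suc i) Pi)) (∣p∣≤∣x∷p∣ b p)

    count-++ʳ : (xs : Vec A m) (ys : Vec A n) → count P? ys ≤ count P? (xs ++ ys)
    count-++ʳ []       ys = ℕₚ.≤-refl
    count-++ʳ (x ∷ xs) ys with P? x
    ... | yes _ = ℕₚ.m≤n⇒m≤1+n (count-++ʳ xs ys)
    ... | no _  = count-++ʳ xs ys

    count-replicate-++ : ∀ m {x} (ys : Vec A n) → P x → m ≤ count P? (replicate m x ++ ys)
    count-replicate-++ ℕ.zero  ys Px = ℕ.z≤n
    count-replicate-++ (suc m) {x} ys Px with P? x
    ... | yes _  = ℕ.s≤s (count-replicate-++ m ys Px)
    ... | no ¬Px = ⊥-elim (¬Px Px)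

  -- The length is the literal sum of the block lengths, with 0 for the final `[]`; `robots` has the
  -- same shape.
  formation : ∀ a b → Vec (Side × Role) (a + (b + (a + (b + 0))))
  formation a b = replicate a (left , fixed) ++ replicate b (left , mobile) ++
                  replicate a (right , fixed) ++ replicate b (right , mobile) ++ []

  size : Role → ℕ → ℕ → ℕ
  size fixed  a b = a
  size mobile a b = b

  formation-count : (_≟_ : (g h : Side × Role) → Dec (g ≡ h)) → ∀ a b σ ρ →
    size ρ a b ≤ count (λ g → g ≟ (σ , ρ)) (formation a b)
  formation-count _≟_ a b left fixed = count-replicate-++ (_≟ (left , fixed)) a _ refl
  formation-count _≟_ a b left mobile = ℕₚ.≤-trans
    (count-replicate-++ (_≟ (left , mobile)) b _ refl)
    (count-++ʳ _ (replicate a (left , fixed)) _)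
  formation-count _≟_ a b right fixed = ℕₚ.≤-trans
    (count-replicate-++ (_≟ (right , fixed)) a _ refl)
    (ℕₚ.≤-trans (count-++ʳ _ (replicate b (left , mobile)) _)
                (count-++ʳ _ (replicate a (left , fixed)) _))
  formation-count _≟_ a b right mobile = ℕₚ.≤-trans
    (count-replicate-++ (_≟ (right , mobile)) b _ refl)
    (ℕₚ.≤-trans (count-++ʳ _ (replicate a (right , fixed)) _)
    (ℕₚ.≤-trans (count-++ʳ _ (replicate b (left , mobile)) _)
                (count-++ʳ _ (replicate a (left , fixed)) _)))

-- The theorem, for f = 5k + 4 and then for f congruent to 4 modulo 5.

open import Data.Nat using (ℕ; _+_; _*_; _<_)
open import Data.Nat.DivMod using (_/_; _%_; m≡m%n+[m/n]*n; m*n/n≡m)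

robots : ℕ → ℕ
robots k = 4 * k + 3 + (3 * k + 3 + (4 * k + 3 + (3 * k + 3 + 0)))

-- The integer division is exact: the numerator is 70k + 60 = 5(14k + 12).
[14f+4]/5≡robots : ∀ k → (14 * (5 * k + 4) + 4) / 5 ≡ robots k
[14f+4]/5≡robots k = trans (cong (_/ 5) (eq k)) (m*n/n≡m (robots k) 5)
  where
  eq : ∀ k → 14 * (5 * k + 4) + 4 ≡
             (4 * k + 3 + (3 * k + 3 + (4 * k + 3 + (3 * k + 3 + 0)))) * 5
  eq = solve-∀

theorem3-5k+4 : ExcludedMiddle 0ℓ → (R : Reals) → ∀ k →
  Search.S[_,_]≤_·d R (robots k) (5 * k + 4) (Reals.fromℕ R 3)
theorem3-5k+4 em R k = search , search-time
  where
  open Formation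
  group : Fin (robots k) → Side × Role
  group = lookup (formation (4 * k + 3) (3 * k + 3))
  open Strategy em R k (λ i → proj₁ (group i)) (λ i → proj₂ (group i))
  squad-large : ∀ σ ρ → size ρ (4 * k + 3) (3 * k + 3) ℕ.≤ ∣ squad σ ρ ∣
  squad-large σ ρ = ℕₚ.≤-trans (formation-count (λ _ _ → em) _ _ σ ρ)
    (count≤∣∣ (λ _ → em) (formation (4 * k + 3) (3 * k + 3)) (squad σ ρ)
      (λ i eq → ∈⟦⟧⁺ (cong proj₁ eq , cong proj₂ eq)))
  open Correctness (λ σ → squad-large σ fixed) (λ σ → squad-large σ mobile)

theorem3 : ExcludedMiddle 0ℓ → (R : Reals) → (f : ℕ) → 0 < f → f % 5 ≡ 4 →
    Search.S[_,_]≤_·d R ((14 * f + 4) / 5) f (Reals.fromℕ R 3)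
theorem3 em R f _ f%5≡4 = subst (λ g → Search.S[_,_]≤_·d R ((14 * g + 4) / 5) g (Reals.fromℕ R 3))
  (sym f≡5k+4)
  (subst (λ n → Search.S[_,_]≤_·d R n (5 * k + 4) (Reals.fromℕ R 3))
    (sym ([14f+4]/5≡robots k)) (theorem3-5k+4 em R k))
  where
  k = f / 5
  f≡5k+4 : f ≡ 5 * k + 4
  f≡5k+4 = trans (m≡m%n+[m/n]*n f 5) (trans (cong (_+ k * 5) f%5≡4) (eq k))
    where
    eq : ∀ k → 4 + k * 5 ≡ 5 * k + 4
    eq = solve-∀
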